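{- Let $n\geq 8$ and $m\geq 4$ be integers with $n\equiv 2 \pmod 6$. Let $G_{n,m}$ be the graph consisting of a cycle $C_n$ with vertices $u_1,\dots,u_n$ (edges $u_iu_{i+1}$ for $1\le i<n$ and $u_nu_1$), a complete graph $K_m$ with vertex set $\{w_1,w_2,v_1,\dots,v_{m-2}\}$, and the additional edges $u_1w_1$, $u_1w_2$, $u_5w_1$, $u_5w_2$. Then $\gamma_g^t(G_{n,m}) = \frac{2n-1}{3}+2$ and $\gamma_g^t(G_{n,m}|w_1) = \frac{2n-1}{3}$.
   Context: The total domination game on a graph $G$ in which a set $S\subseteq V(G)$ is predominated: two players, Dominator and Staller, alternately choose vertices of $G$. A vertex $w$ is totally dominated if it lies in $S$ or if some neighbor of $w$ has already been chosen (a vertex does not totally dominate itself). A vertex may be chosen only if it has at least one neighbor that is not yet totally dominated. The game ends when no legal move remains. Dominator aims to minimize and Staller to maximize the total number of moves. $\gamma_g^t(G|S)$ is the number of moves when Dominator starts and both play optimally; $\gamma_g^t(G)=\gamma_g^t(G|\emptyset)$ and $\gamma_g^t(G|v)=\gamma_g^t(G|\{v\})$. -}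

module Defs where

open import Data.Bool using (Bool; true; false; _∧_; _∨_; not; if_then_else_)
open import Data.Nat using (ℕ; zero; suc; _+_; _∸_; _<ᵇ_; _≡ᵇ_; _⊓_; _⊔_)
open import Data.Fin using (Fin; toℕ)
open import Data.List using (List; []; _∷_; map; foldr; filterᵇ; allFin)
open import Data.Bool.ListAction using (any)

record Graph (N : ℕ) : Set where
  field
    adj       : Fin N → Fin N → Bool

VSet : ℕ → Set
VSet N = Fin N → Bool

∅ : ∀ {N} → VSet N
∅ _ = false

singleton : ∀ {N} → Fin N → VSet N
singleton {N} v x = toℕ v ≡ᵇ toℕ x

-- The total domination game.
-- The game state is the set D of vertices that are already totally
-- dominated (initially the predominated set S).  Choosing v adds the
-- open neighbourhood N(v) to D.  v is a legal move iff v has a neighbour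
-- that is not in D.

data Player : Set where
  Dominator Staller : Player

other : Player → Player
other Dominator = Staller
other Staller   = Dominator

module TotalDominationGame {N : ℕ} (G : Graph N) where
  open Graph G

  afterMove : VSet N → Fin N → VSet N
  afterMove D v x = D x ∨ adj v x

  legal : VSet N → Fin N → Bool
  legal D v = any (λ u → adj v u ∧ not (D u)) (allFin N)

  opt : Player → ℕ → List ℕ → ℕ
  opt Dominator x xs = foldr _⊓_ x xs
  opt Staller   x xs = foldr _⊔_ x xs

  -- value of the game (number of remaining moves under optimal play)
  -- with p to move and totally dominated set D, computed with a fuel
  -- bound.  Every legal move adds at least one new vertex to D, so the
  -- game lasts at most N moves and fuel (suc N) is always sufficient.
  value : ℕ → Player → VSet N → ℕ
  value zero    p D = 0
  value (suc k) p D with map (λ v → value k (other p) (afterMove D v))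
                             (filterᵇ (legal D) (allFin N))
  ... | []     = 0
  ... | x ∷ xs = suc (opt p x xs)

  γgt∣ : VSet N → ℕ
  γgt∣ S = value (suc N) Dominator S

  γgt : ℕ
  γgt = γgt∣ ∅

-- The graph G_{n,m}, on vertex set Fin (n + m).
-- Index i < n   is u_{i+1}   (so u_1 = 0, u_5 = 4, u_n = n-1),
-- index n       is w_1,
-- index n + 1   is w_2,
-- index n + 1 + j (1 ≤ j ≤ m-2) is v_j.

adjℕ : ℕ → ℕ → ℕ → Bool
adjℕ n a b =
  if a <ᵇ n then
    (if b <ᵇ n then cyc else hub a b)
  else
    (if b <ᵇ n then hub b a else not (a ≡ᵇ b))
  where
    cyc : Bool
    cyc = (b ≡ᵇ suc a) ∨ (a ≡ᵇ suc b)
          ∨ ((a ≡ᵇ 0) ∧ (b ≡ᵇ n ∸ 1)) ∨ ((b ≡ᵇ 0) ∧ (a ≡ᵇ n ∸ 1))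
    hub : ℕ → ℕ → Bool
    hub c x = ((c ≡ᵇ 0) ∨ (c ≡ᵇ 4)) ∧ ((x ≡ᵇ n) ∨ (x ≡ᵇ suc n))

Gnm : (n m : ℕ) → Graph (n + m)
Gnm n m = record { adj = λ x y → adjℕ n (toℕ x) (toℕ y) }

w₁ : (n m : ℕ) → VSet (n + m)
w₁ n m x = toℕ x ≡ᵇ n

{-# OPTIONS --safe #-}
module Submission where

open import Defs
open import Data.Bool using (Bool; true; false; _∧_; _∨_; not; T)
open import Data.Bool.Properties using (T-≡; T?; ∧-identityʳ; ∨-comm; ∨-identityʳ; ∨-zeroʳ)
open import Data.Empty using (⊥; ⊥-elim)
open import Data.Fin using (Fin; toℕ; fromℕ<)
import Data.Fin.Properties as Fin
open import Data.List using (List; []; _∷_; _++_; allFin; applyUpTo; filterᵇ; foldr; map; replicate)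
open import Data.List.Membership.Propositional using (_∈_; find; lose)
open import Data.List.Membership.Propositional.Properties
  using (∈-allFin; ∈-filter⁺; ∈-filter⁻; ∈-map⁺; ∈-map⁻)
open import Data.List.Relation.Unary.Any using (here; there)
open import Data.List.Relation.Unary.Any.Properties using (any⁺; any⁻)
open import Data.Nat
open import Data.Nat.DivMod
open import Data.Nat.Properties
open import Data.Nat.Tactic.RingSolver using (solve-∀)
open import Data.Product using (_×_; _,_; ∃; ∃-syntax; proj₁; proj₂)
open import Data.Sum using (_⊎_; inj₁; inj₂; [_,_]′) renaming (map to ⊎-map; map₂ to ⊎-map₂)
open import Data.Unit using (⊤; tt)
open import Function using (_∘_; id; Equivalence)
open import Relation.Binary.PropositionalEquality
open import Relation.Nullary using (¬_; Dec; yes; no)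

-- The even cycle falls apart into two cyclic sequences of L = 3k + 1 targets, and choosing a cycle vertex
-- covers two consecutive targets of one of them.  Once a target is dominated, the position of a sequence is
-- its list of maximal runs of undominated targets, and a move shortens or splits a run.  Weigh a run of
-- length ℓ by ⌊(2ℓ + 1)/3⌋ for the lower bounds.  Any move of Dominator lowers the total weight by at most 1,
-- or by 2 while creating a run with ℓ ≡ 2 (mod 3); Staller can shorten such a run free of charge, and can
-- always move at cost at most 1, so two moves cost at most 2.  The upper bounds are dual, with weight ⌈2ℓ/3⌉:
-- a move of Staller gains at least 1, or nothing while creating a run with ℓ ≡ 2, from which Dominator then
-- gains 2.  A sequence that has not been entered yet is accounted for by a parity argument, since the player
-- who has to enter it loses a move.
-- With w₁ predominated Dominator starts with w₁, which settles the clique.  With nothing predominated, Staller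
-- answers the first move by some v_i; either the clique is settled, or v_i itself stays undominated and Staller
-- can use that for a spare move later.

-- The two weights agree on residues 0 and 1 and differ by one on residue 2. Write k = k′ + 1 and
-- `P` = 2k, so that L = 4 + 3k′. Entering a sequence by an edge move leaves one run of length L -
-- 2, of residue 2, with lower weight P - 1 and upper weight P. Entering it by w₁ or w₂ leaves runs
-- of lengths 1 and L - 3, and both weights equal P. A start with w₁ thus takes one move plus P for
-- each sequence, and 2P + 1 = (2n - 1)/3. The obstacle is that clique and cycle are not
-- independent: w₁ and w₂ cover two targets at distance two in one of the sequences, and a run split
-- in this way needs its own estimate. Two general principles shorten the work. Dominating more
-- never prolongs the game, so one position, with the clique settled and u₁, u₅ dominated, bounds
-- from below both the game with w₁ predominated and the continuation after an opening in the
-- clique. And forgetting one predominated vertex adds at most two moves, which turns Dominator's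
-- strategy for w₁ into the other upper bound.

-- lower ℓ = ⌊(2ℓ + 1)/3⌋ and upper ℓ = ⌈2ℓ/3⌉.
lower : ℕ → ℕ
lower 0 = 0
lower 1 = 1
lower 2 = 1
lower (suc (suc (suc ℓ))) = 2 + lower ℓ

upper : ℕ → ℕ
upper 0 = 0
upper 1 = 1
upper 2 = 2
upper (suc (suc (suc ℓ))) = 2 + upper ℓ

Res2 : ℕ → Set
Res2 0 = ⊥
Res2 1 = ⊥
Res2 2 = ⊤
Res2 (suc (suc (suc ℓ))) = Res2 ℓ

-- In the lists below true stands for a dominated vertex.  The number argument of the three functions is the
-- length of the run of undominated vertices that ends where the list starts.
scan : (ℕ → ℕ) → ℕ → List Bool → ℕ
scan f ℓ [] = f ℓ
scan f ℓ (true ∷ bs) = f ℓ + scan f 0 bs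
scan f ℓ (false ∷ bs) = scan f (suc ℓ) bs

HasRes2 : ℕ → List Bool → Set
HasRes2 ℓ [] = Res2 ℓ
HasRes2 ℓ (true ∷ bs) = Res2 ℓ ⊎ HasRes2 0 bs
HasRes2 ℓ (false ∷ bs) = HasRes2 (suc ℓ) bs

OnlyRes2 : ℕ → List Bool → Set
OnlyRes2 ℓ [] = ℓ ≡ 0 ⊎ Res2 ℓ
OnlyRes2 ℓ (true ∷ bs) = (ℓ ≡ 0 ⊎ Res2 ℓ) × OnlyRes2 0 bs
OnlyRes2 ℓ (false ∷ bs) = OnlyRes2 (suc ℓ) bs

-- `R` stands for the presence of a run of residue 2 after the move. It is the only excuse for the
-- second alternative, in which the weight drops by two or the gain is zero.
Drop Gain : ℕ → ℕ → Set → Set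
Drop a b R = a ≤ suc b ⊎ R × a ≤ 2 + b
Gain a b R = suc b ≤ a ⊎ R × b ≤ a

-- What the passage from one run to a whole list requires: a common weight may be added on both
-- sides, and the exceptional condition may be enlarged. One induction then serves `Drop`, `Gain`
-- and `AtMost1`.
record Comparison (C : ℕ → ℕ → Set → Set) : Set₁ where
  field
    shift : ∀ c {a b R} → C a b R → C (c + a) (c + b) R
    weaken : ∀ {a b R R′} → (R → R′) → C a b R → C a b R′

  shiftʳ : ∀ c {a b R} → C a b R → C (a + c) (b + c) R
  shiftʳ c {a} {b} {R} h = subst₂ (λ x y → C x y R) (+-comm c a) (+-comm c b) (shift c h)

open Comparison

≤suc-shift : ∀ c {a b} → a ≤ suc b → c + a ≤ suc (c + b)
≤suc-shift c {a} {b} h = subst (c + a ≤_) (+-suc c b) (+-monoʳ-≤ c h)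

suc≤-shift : ∀ c {a b} → suc b ≤ a → suc (c + b) ≤ c + a
suc≤-shift c {a} {b} h = subst (_≤ c + a) (+-suc c b) (+-monoʳ-≤ c h)

drop-comparison : Comparison Drop
drop-comparison .shift c (inj₁ h) = inj₁ (≤suc-shift c h)
drop-comparison .shift c {a} {b} (inj₂ (r , h)) =
  inj₂ (r , subst (c + a ≤_) (trans (+-suc c (suc b)) (cong suc (+-suc c b))) (+-monoʳ-≤ c h))
drop-comparison .weaken f = ⊎-map₂ λ (r , h) → f r , h

gain-comparison : Comparison Gain
gain-comparison .shift c (inj₁ h) = inj₁ (suc≤-shift c h)
gain-comparison .shift c (inj₂ (r , h)) = inj₂ (r , +-monoʳ-≤ c h)
gain-comparison .weaken f = ⊎-map₂ λ (r , h) → f r , h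

AtMost1 : ℕ → ℕ → Set → Set
AtMost1 a b _ = a ≤ suc b

atMost1-comparison : Comparison AtMost1
atMost1-comparison .shift c h = ≤suc-shift c h
atMost1-comparison .weaken _ h = h

pattern _+3 n = suc (suc (suc n))

lower-suc : ∀ ℓ → lower (suc ℓ) ≤ suc (lower ℓ)
lower-suc 0 = ≤-refl
lower-suc 1 = s≤s z≤n
lower-suc 2 = ≤-refl
lower-suc (ℓ +3) = s≤s (s≤s (lower-suc ℓ))

module _ {C : ℕ → ℕ → Set → Set} (cmp : Comparison C) where

  cast : ∀ {a b b′ R} → b ≡ b′ → C a b R → C a b′ R
  cast refl h = h

  -- Adding 3 to the right-hand run changes both weights by 2, so only the residues 0, 1, 2 matter.
  by-residue : ∀ (f : ℕ → ℕ) → (∀ j → f (j +3) ≡ 2 + f j) → ∀ {R d e} →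
    C (f d) (e + f 0) (R ⊎ Res2 0) → C (f (1 + d)) (e + f 1) (R ⊎ Res2 1) →
    C (f (2 + d)) (e + f 2) (R ⊎ Res2 2) →
    ∀ j → C (f (j + d)) (e + f j) (R ⊎ Res2 j)
  by-residue f f3 c₀ c₁ c₂ 0 = c₀
  by-residue f f3 c₀ c₁ c₂ 1 = c₁
  by-residue f f3 c₀ c₁ c₂ 2 = c₂
  by-residue f f3 {R} {d} {e} c₀ c₁ c₂ (j +3) =
    subst₂ (λ x y → C x y (R ⊎ Res2 j)) (sym (f3 (j + d)))
      (trans (sym (trans (+-suc e (suc (f j))) (cong suc (+-suc e (f j))))) (cong (e +_) (sym (f3 j))))
      (shift cmp 2 (by-residue f f3 c₀ c₁ c₂ j))

  -- The entries after the changed block may prolong its right-hand run, so the estimate for a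
  -- single run is carried along until that run closes. Here `j` is the current length of the
  -- right-hand run, `d` the number of further entries the run had before the move, and `e` the
  -- weight split off to the left.
  merge : ∀ (f : ℕ → ℕ) {R d e} → (∀ j → C (f (j + d)) (e + f j) (R ⊎ Res2 j)) →
    ∀ j bs → C (scan f (j + d) bs) (e + scan f j bs) (R ⊎ HasRes2 j bs)
  merge f h j [] = h j
  merge f {e = e} h j (true ∷ bs) =
    cast (+-assoc e (f j) _)
      (weaken cmp [ inj₁ , inj₂ ∘ inj₁ ]′ (shiftʳ cmp (scan f 0 bs) (h j)))
  merge f h j (false ∷ bs) = merge f h (suc j) bs

-- A move is a local rewriting of the list. Induction on this relation reduces an estimate to the
-- block itself, with an arbitrary length of the run coming in from the left.
data At (p q : List Bool) : ℕ → List Bool → List Bool → Set where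
  here  : ∀ {bs} → At p q 0 (p ++ bs) (q ++ bs)
  there : ∀ {j b bs bs′} → At p q j bs bs′ → At p q (suc j) (b ∷ bs) (b ∷ bs′)

at-compare : ∀ {C} → Comparison C → ∀ f {p q} →
  (∀ ℓ bs → C (scan f ℓ (p ++ bs)) (scan f ℓ (q ++ bs)) (HasRes2 ℓ (q ++ bs))) →
  ∀ {j bs bs′} → At p q j bs bs′ → ∀ ℓ → C (scan f ℓ bs) (scan f ℓ bs′) (HasRes2 ℓ bs′)
at-compare cmp f h here ℓ = h ℓ _
at-compare cmp f h (there {b = true} a) ℓ = weaken cmp inj₂ (shift cmp (f ℓ) (at-compare cmp f h a 0))
at-compare cmp f h (there {b = false} a) ℓ = at-compare cmp f h a (suc ℓ)

-- Change of weight when a run is shortened or split.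

lower-split₁ : ∀ ℓ j → lower (j + suc ℓ) ≤ suc (lower ℓ + lower j)
lower-split₁ ℓ = by-residue atMost1-comparison lower (λ _ → refl) {R = ⊥} (c₀ ℓ) (c₁ ℓ) (c₂ ℓ)
  where
  c₀ : ∀ ℓ → lower (suc ℓ) ≤ suc (lower ℓ + 0)
  c₀ 0 = s≤s z≤n
  c₀ 1 = s≤s z≤n
  c₀ 2 = s≤s (s≤s z≤n)
  c₀ (ℓ +3) = s≤s (s≤s (c₀ ℓ))
  c₁ : ∀ ℓ → lower (2 + ℓ) ≤ suc (lower ℓ + 1)
  c₁ 0 = s≤s z≤n
  c₁ 1 = s≤s (s≤s z≤n)
  c₁ 2 = s≤s (s≤s (s≤s z≤n))
  c₁ (ℓ +3) = s≤s (s≤s (c₁ ℓ))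
  c₂ : ∀ ℓ → lower (3 + ℓ) ≤ suc (lower ℓ + 1)
  c₂ ℓ = s≤s (subst (suc (lower ℓ) ≤_) (+-comm 1 (lower ℓ)) ≤-refl)

-- Two entries are worth 4/3 on average, so rounding decides. The drop is two only when the residues
-- of the two parts are (2, 0), (0, 2) or (2, 2), and each of these pairs contains a 2.
lower-split₂ : ∀ ℓ j → Drop (lower (j + (2 + ℓ))) (lower ℓ + lower j) (Res2 ℓ ⊎ Res2 j)
lower-split₂ ℓ = by-residue drop-comparison lower (λ _ → refl) (c₀ ℓ) (c₁ ℓ) (c₂ ℓ)
  where
  sh : ∀ {a b R} → Drop a b R → Drop (2 + a) (2 + b) R
  sh = shift drop-comparison 2
  c₀ : ∀ ℓ → Drop (lower (2 + ℓ)) (lower ℓ + 0) (Res2 ℓ ⊎ ⊥)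
  c₀ 0 = inj₁ (s≤s z≤n)
  c₀ 1 = inj₁ (s≤s (s≤s z≤n))
  c₀ 2 = inj₂ (inj₁ tt , ≤-refl)
  c₀ (ℓ +3) = sh (c₀ ℓ)
  c₁ : ∀ ℓ → Drop (lower (3 + ℓ)) (lower ℓ + 1) (Res2 ℓ ⊎ ⊥)
  c₁ 0 = inj₁ ≤-refl
  c₁ 1 = inj₁ ≤-refl
  c₁ 2 = inj₁ ≤-refl
  c₁ (ℓ +3) = sh (c₁ ℓ)
  c₂ : ∀ ℓ → Drop (lower (4 + ℓ)) (lower ℓ + 1) (Res2 ℓ ⊎ ⊤)
  c₂ 0 = inj₂ (inj₂ tt , ≤-refl)
  c₂ 1 = inj₁ (s≤s (s≤s (s≤s z≤n)))
  c₂ 2 = inj₂ (inj₂ tt , ≤-refl)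
  c₂ (ℓ +3) = sh (c₂ ℓ)

-- This is a hub vertex covering the outer two of three undominated targets. The middle one survives
-- as a run of length 1, whose weight is the `suc` on the right.
lower-split₃ : ∀ ℓ j → Drop (lower (j + (3 + ℓ))) (suc (lower ℓ) + lower j) (Res2 ℓ ⊎ Res2 j)
lower-split₃ ℓ = by-residue drop-comparison lower (λ _ → refl) (c₀ ℓ) (c₁ ℓ) (c₂ ℓ)
  where
  sh : ∀ {a b R} → Drop a b R → Drop (2 + a) (2 + b) R
  sh = shift drop-comparison 2
  c₀ : ∀ ℓ → Drop (lower (3 + ℓ)) (suc (lower ℓ) + 0) (Res2 ℓ ⊎ ⊥)
  c₀ 0 = inj₁ ≤-refl
  c₀ 1 = inj₁ ≤-refl
  c₀ 2 = inj₁ ≤-refl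
  c₀ (ℓ +3) = sh (c₀ ℓ)
  c₁ : ∀ ℓ → Drop (lower (4 + ℓ)) (suc (lower ℓ) + 1) (Res2 ℓ ⊎ ⊥)
  c₁ 0 = inj₁ ≤-refl
  c₁ 1 = inj₁ (s≤s (s≤s (s≤s z≤n)))
  c₁ 2 = inj₁ ≤-refl
  c₁ (ℓ +3) = sh (c₁ ℓ)
  c₂ : ∀ ℓ → Drop (lower (5 + ℓ)) (suc (lower ℓ) + 1) (Res2 ℓ ⊎ ⊤)
  c₂ 0 = inj₁ ≤-refl
  c₂ 1 = inj₁ (s≤s (s≤s (s≤s (s≤s z≤n))))
  c₂ 2 = inj₂ (inj₂ tt , ≤-refl)
  c₂ (ℓ +3) = sh (c₂ ℓ)

-- The lengths of the two parts add up to a multiple of 3, so their residues are (0, 0), (1, 2) or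
-- (2, 1), and none of these pairs loses two.
lower-split₂-res2 : ∀ ℓ j → Res2 (j + (2 + ℓ)) → lower (j + (2 + ℓ)) ≤ suc (lower ℓ + lower j)
lower-split₂-res2 ℓ (j +3) r =
  subst (λ x → 2 + lower (j + (2 + ℓ)) ≤ suc x) (sym (trans (+-suc (lower ℓ) _) (cong suc (+-suc (lower ℓ) _))))
    (s≤s (s≤s (lower-split₂-res2 ℓ j r)))
lower-split₂-res2 (ℓ +3) 0 r = s≤s (s≤s (lower-split₂-res2 ℓ 0 r))
lower-split₂-res2 (ℓ +3) 1 r = s≤s (s≤s (lower-split₂-res2 ℓ 1 r))
lower-split₂-res2 (ℓ +3) 2 r = s≤s (s≤s (lower-split₂-res2 ℓ 2 r))
lower-split₂-res2 0 0 r = s≤s z≤n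
lower-split₂-res2 2 1 r = ≤-refl
lower-split₂-res2 1 2 r = ≤-refl

upper-shrink : ∀ ℓ → Gain (upper (suc ℓ)) (upper ℓ) (Res2 ℓ)
upper-shrink 0 = inj₁ ≤-refl
upper-shrink 1 = inj₁ ≤-refl
upper-shrink 2 = inj₂ (tt , ≤-refl)
upper-shrink (ℓ +3) = shift gain-comparison 2 (upper-shrink ℓ)

upper-split₂ : ∀ ℓ j → Gain (upper (j + (2 + ℓ))) (upper ℓ + upper j) (Res2 ℓ ⊎ Res2 j)
upper-split₂ ℓ = by-residue gain-comparison upper (λ _ → refl) (c₀ ℓ) (c₁ ℓ) (c₂ ℓ)
  where
  sh : ∀ {a b R} → Gain a b R → Gain (2 + a) (2 + b) R
  sh = shift gain-comparison 2
  c₀ : ∀ ℓ → Gain (upper (2 + ℓ)) (upper ℓ + 0) (Res2 ℓ ⊎ ⊥)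
  c₀ 0 = inj₁ (s≤s z≤n)
  c₀ 1 = inj₁ ≤-refl
  c₀ 2 = inj₁ ≤-refl
  c₀ (ℓ +3) = sh (c₀ ℓ)
  c₁ : ∀ ℓ → Gain (upper (3 + ℓ)) (upper ℓ + 1) (Res2 ℓ ⊎ ⊥)
  c₁ 0 = inj₁ ≤-refl
  c₁ 1 = inj₁ ≤-refl
  c₁ 2 = inj₁ ≤-refl
  c₁ (ℓ +3) = sh (c₁ ℓ)
  c₂ : ∀ ℓ → Gain (upper (4 + ℓ)) (upper ℓ + 2) (Res2 ℓ ⊎ ⊤)
  c₂ 0 = inj₁ ≤-refl
  c₂ 1 = inj₁ ≤-refl
  c₂ 2 = inj₂ (inj₂ tt , ≤-refl)
  c₂ (ℓ +3) = sh (c₂ ℓ)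

upper-two : ∀ ℓ → suc (upper ℓ) ≤ upper (2 + ℓ)
upper-two 0 = s≤s z≤n
upper-two 1 = ≤-refl
upper-two 2 = ≤-refl
upper-two (ℓ +3) = s≤s (s≤s (upper-two ℓ))

upper-two-res2 : ∀ ℓ → Res2 (2 + ℓ) → 2 + upper ℓ ≤ upper (2 + ℓ)
upper-two-res2 0 _ = ≤-refl
upper-two-res2 (ℓ +3) r = s≤s (s≤s (upper-two-res2 ℓ r))

lower-res2 : ∀ ℓ → Res2 (suc ℓ) → lower (suc ℓ) ≤ lower ℓ
lower-res2 1 _ = ≤-refl
lower-res2 (ℓ +3) r = s≤s (s≤s (lower-res2 ℓ r))

-- Moves on a list of runs.

edge-drop : ∀ {x y j bs bs′} → At (x ∷ y ∷ []) (true ∷ true ∷ []) j bs bs′ →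
  Drop (scan lower 0 bs) (scan lower 0 bs′) (HasRes2 0 bs′)
edge-drop {x} {y} a = at-compare drop-comparison lower (base x y) a 0
  where
  base : ∀ x y ℓ bs → Drop (scan lower ℓ (x ∷ y ∷ bs)) (scan lower ℓ (true ∷ true ∷ bs)) (HasRes2 ℓ (true ∷ true ∷ bs))
  base true true ℓ bs = inj₁ (n≤1+n _)
  base true false ℓ bs =
    inj₁ (≤suc-shift (lower ℓ) (merge atMost1-comparison lower {R = ⊥} {1} {0} (lower-split₁ 0) 0 bs))
  base false true ℓ bs = inj₁ (+-monoˡ-≤ (scan lower 0 bs) (lower-suc ℓ))
  base false false ℓ bs = weaken drop-comparison (⊎-map₂ inj₂) (merge drop-comparison lower (lower-split₂ ℓ) 0 bs)

-- A position all of whose runs have residue 2 offers no edge move that costs two. A sequence just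
-- entered by an edge is in this situation.
edge-drop-onlyRes2 : ∀ {x y j bs bs′} → At (x ∷ y ∷ []) (true ∷ true ∷ []) j bs bs′ →
  ∀ ℓ → OnlyRes2 ℓ bs → scan lower ℓ bs ≤ suc (scan lower ℓ bs′)
edge-drop-onlyRes2 {true} {true} here ℓ o = n≤1+n _
edge-drop-onlyRes2 {true} {false} (here {bs}) ℓ o =
  ≤suc-shift (lower ℓ) (merge atMost1-comparison lower {R = ⊥} {1} {0} (lower-split₁ 0) 0 bs)
edge-drop-onlyRes2 {false} {true} (here {bs}) ℓ o = +-monoˡ-≤ (scan lower 0 bs) (lower-suc ℓ)
edge-drop-onlyRes2 {false} {false} (here {bs}) ℓ o = go 0 bs o
  where
  go : ∀ j bs → OnlyRes2 (j + (2 + ℓ)) bs → scan lower (j + (2 + ℓ)) bs ≤ suc (lower ℓ + scan lower j bs)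
  run : ∀ j → j + (2 + ℓ) ≡ 0 ⊎ Res2 (j + (2 + ℓ)) → lower (j + (2 + ℓ)) ≤ suc (lower ℓ + lower j)
  run j (inj₂ r) = lower-split₂-res2 ℓ j r
  run zero (inj₁ ())
  run (suc j) (inj₁ ())
  go j [] o = run j o
  go j (true ∷ bs) (o , _) = subst (lower (j + (2 + ℓ)) + scan lower 0 bs ≤_) (cong suc (+-assoc (lower ℓ) (lower j) _))
    (+-monoˡ-≤ (scan lower 0 bs) (run j o))
  go j (false ∷ bs) o = go (suc j) bs o
edge-drop-onlyRes2 (there {b = true} a) ℓ (_ , o) = ≤suc-shift (lower ℓ) (edge-drop-onlyRes2 a 0 o)
edge-drop-onlyRes2 (there {b = false} a) ℓ o = edge-drop-onlyRes2 a (suc ℓ) o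

-- For a hub vertex one of whose two targets is dominated already: it then acts on a single entry.
single-drop : ∀ {b j bs bs′} → At (b ∷ []) (true ∷ []) j bs bs′ → scan lower 0 bs ≤ suc (scan lower 0 bs′)
single-drop {b} a = at-compare atMost1-comparison lower (base b) a 0
  where
  base : ∀ b ℓ bs → scan lower ℓ (b ∷ bs) ≤ suc (scan lower ℓ (true ∷ bs))
  base true ℓ bs = n≤1+n _
  base false ℓ bs = merge atMost1-comparison lower {R = ⊥} (lower-split₁ ℓ) 0 bs

double-drop : ∀ {j bs bs′} →
  At (false ∷ false ∷ false ∷ []) (true ∷ false ∷ true ∷ []) j bs bs′ →
  Drop (scan lower 0 bs) (scan lower 0 bs′) (HasRes2 0 bs′)
double-drop a = at-compare drop-comparison lower base a 0
  where
  base : ∀ ℓ bs → Drop (scan lower ℓ (false ∷ false ∷ false ∷ bs)) (scan lower ℓ (true ∷ false ∷ true ∷ bs))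
                       (HasRes2 ℓ (true ∷ false ∷ true ∷ bs))
  base ℓ bs = cast drop-comparison (sym (+-suc (lower ℓ) _))
    (weaken drop-comparison (⊎-map₂ inj₂) (merge drop-comparison lower (lower-split₃ ℓ) 0 bs))

edge-gain : ∀ {x y j bs bs′} → x ≡ false ⊎ y ≡ false → At (x ∷ y ∷ []) (true ∷ true ∷ []) j bs bs′ →
  Gain (scan upper 0 bs) (scan upper 0 bs′) (HasRes2 0 bs′)
edge-gain {x} {y} f a = at-compare gain-comparison upper (base x y f) a 0
  where
  base : ∀ x y → x ≡ false ⊎ y ≡ false → ∀ ℓ bs →
    Gain (scan upper ℓ (x ∷ y ∷ bs)) (scan upper ℓ (true ∷ true ∷ bs)) (HasRes2 ℓ (true ∷ true ∷ bs))
  base true true (inj₁ ())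
  base true true (inj₂ ())
  base true false _ ℓ bs = weaken gain-comparison (inj₂ ∘ [ (λ ()) , inj₂ ]′)
    (shift gain-comparison (upper ℓ) (merge gain-comparison upper {R = ⊥} {1} {0} shrink 0 bs))
    where
    shrink : ∀ j → Gain (upper (j + 1)) (upper j) (⊥ ⊎ Res2 j)
    shrink j = weaken gain-comparison inj₂ (subst (λ x → Gain (upper x) (upper j) (Res2 j)) (+-comm 1 j) (upper-shrink j))
  base false true _ ℓ bs = weaken gain-comparison inj₁ (shiftʳ gain-comparison (scan upper 0 bs) (upper-shrink ℓ))
  base false false _ ℓ bs = weaken gain-comparison (⊎-map₂ inj₂) (merge gain-comparison upper (upper-split₂ ℓ) 0 bs)

-- `EndsTrue b bs`: the last entry of b ∷ bs is true, so that every run is closed.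
EndsTrue : Bool → List Bool → Set
EndsTrue b [] = b ≡ true
EndsTrue _ (b ∷ bs) = EndsTrue b bs

-- The first entry of the pair is `false`; it later provides the witness that the move is legal.
EdgeChoice : List Bool → (List Bool → Set) → Set
EdgeChoice bs P = ∃[ y ] ∃[ j ] ∃[ bs′ ] At (false ∷ y ∷ []) (true ∷ true ∷ []) j bs bs′ × P bs′

choice-there : ∀ {b bs} {P Q : List Bool → Set} → (∀ {bs′} → P bs′ → Q (b ∷ bs′)) →
  EdgeChoice bs P → EdgeChoice (b ∷ bs) Q
choice-there f (y , j , bs′ , a , p) = y , suc j , _ , there a , f p

-- Shortening a run of residue 2 by its last vertex does not change its lower weight.
lower-free-move : ∀ bs → EndsTrue true bs → HasRes2 0 bs → EdgeChoice bs λ bs′ → scan lower 0 bs ≤ scan lower 0 bs′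
lower-free-move = closed
  where
  closed : ∀ bs → EndsTrue true bs → HasRes2 0 bs → EdgeChoice bs λ bs′ → scan lower 0 bs ≤ scan lower 0 bs′
  inRun : ∀ ℓ bs → EndsTrue false bs → HasRes2 (suc ℓ) bs →
    EdgeChoice (false ∷ bs) λ bs′ → scan lower (suc ℓ) bs ≤ scan lower ℓ bs′
  closed (true ∷ bs) e (inj₂ r) = choice-there id (closed bs e r)
  closed (false ∷ bs) e r = inRun 0 bs e r
  inRun ℓ (true ∷ bs) e (inj₁ r) = true , 0 , _ , here , +-monoˡ-≤ (scan lower 0 bs) (lower-res2 ℓ r)
  inRun ℓ (true ∷ bs) e (inj₂ r) =
    choice-there id (choice-there (+-monoʳ-≤ (lower (suc ℓ))) (closed bs e r))
  inRun ℓ (false ∷ bs) e r = choice-there id (inRun (suc ℓ) bs e r)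

-- Staller covers the last target of the first run together with the dominated one after it, so that
-- half of the edge is wasted.
lower-unit-move : ∀ bs → EndsTrue true bs → 1 ≤ scan lower 0 bs →
  EdgeChoice bs λ bs′ → scan lower 0 bs ≤ suc (scan lower 0 bs′)
lower-unit-move (true ∷ bs) e h = choice-there id (lower-unit-move bs e h)
lower-unit-move (false ∷ bs) e h = inRun 0 bs e
  where
  inRun : ∀ ℓ bs → EndsTrue false bs → EdgeChoice (false ∷ bs) λ bs′ → scan lower (suc ℓ) bs ≤ suc (scan lower ℓ bs′)
  inRun ℓ (true ∷ bs) e = true , 0 , _ , here , +-monoˡ-≤ (scan lower 0 bs) (lower-suc ℓ)
  inRun ℓ (false ∷ bs) e = choice-there id (inRun (suc ℓ) bs e)

upper-unit-move : ∀ bs → EndsTrue true bs → 1 ≤ scan upper 0 bs →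
  EdgeChoice bs λ bs′ → suc (scan upper 0 bs′) ≤ scan upper 0 bs
upper-unit-move (true ∷ bs) e h = choice-there id (upper-unit-move bs e h)
upper-unit-move (false ∷ true ∷ bs) e h = true , 0 , _ , here , ≤-refl
upper-unit-move (false ∷ false ∷ bs) e h = false , 0 , _ , here , inRun 0 bs
  where
  inRun : ∀ ℓ bs → suc (scan upper ℓ bs) ≤ scan upper (2 + ℓ) bs
  inRun ℓ [] = upper-two ℓ
  inRun ℓ (true ∷ bs) = +-monoˡ-≤ (scan upper 0 bs) (upper-two ℓ)
  inRun ℓ (false ∷ bs) = inRun (suc ℓ) bs

-- Removing two entries at the end of a run gains exactly one for residues 0 and 1, but two from
-- residue 2 to residue 0. This reply pays for a preceding move of Staller that gained nothing.
upper-double-move : ∀ bs → EndsTrue true bs → HasRes2 0 bs →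
  EdgeChoice bs λ bs′ → 2 + scan upper 0 bs′ ≤ scan upper 0 bs
upper-double-move = closed
  where
  closed : ∀ bs → EndsTrue true bs → HasRes2 0 bs → EdgeChoice bs λ bs′ → 2 + scan upper 0 bs′ ≤ scan upper 0 bs
  inRun : ∀ ℓ bs → EndsTrue false bs → HasRes2 (2 + ℓ) bs →
    EdgeChoice (false ∷ false ∷ bs) λ bs′ → 2 + scan upper ℓ bs′ ≤ scan upper (2 + ℓ) bs
  closed (true ∷ bs) e (inj₂ r) = choice-there id (closed bs e r)
  closed (false ∷ true ∷ bs) e (inj₂ r) = choice-there id (choice-there s≤s (closed bs e r))
  closed (false ∷ false ∷ bs) e r = inRun 0 bs e r
  inRun ℓ (true ∷ bs) e (inj₁ r) = false , 0 , _ , here , +-monoˡ-≤ (scan upper 0 bs) (upper-two-res2 ℓ r)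
  inRun ℓ (true ∷ bs) e (inj₂ r) =
    choice-there id (choice-there id (choice-there (λ {bs′} → shifted {bs′}) (closed bs e r)))
    where
    shifted : ∀ {bs′} → 2 + scan upper 0 bs′ ≤ scan upper 0 bs →
      2 + (upper (2 + ℓ) + scan upper 0 bs′) ≤ upper (2 + ℓ) + scan upper 0 bs
    shifted {bs′} h = subst (_≤ upper (2 + ℓ) + scan upper 0 bs)
      (trans (+-suc (upper (2 + ℓ)) _) (cong suc (+-suc (upper (2 + ℓ)) _))) (+-monoʳ-≤ (upper (2 + ℓ)) h)
  inRun ℓ (false ∷ bs) e r = choice-there id (inRun (suc ℓ) bs e r)

res2-pos : ∀ ℓ bs → HasRes2 ℓ bs → 1 ≤ scan upper ℓ bs
res2-pos ℓ [] r = pos ℓ r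
  where
  pos : ∀ ℓ → Res2 ℓ → 1 ≤ upper ℓ
  pos 2 _ = s≤s z≤n
  pos (ℓ +3) r = s≤s z≤n
res2-pos ℓ (true ∷ bs) (inj₁ r) = ≤-trans (res2-pos ℓ [] r) (m≤m+n (upper ℓ) _)
res2-pos ℓ (true ∷ bs) (inj₂ r) = ≤-trans (res2-pos 0 bs r) (m≤n+m _ (upper ℓ))
res2-pos ℓ (false ∷ bs) r = res2-pos (suc ℓ) bs r

-- Lists read off from predicates on indices.

applyUpTo-cong : ∀ {A : Set} {f g : ℕ → A} k → (∀ i → i < k → f i ≡ g i) → applyUpTo f k ≡ applyUpTo g k
applyUpTo-cong zero h = refl
applyUpTo-cong (suc k) h = cong₂ _∷_ (h 0 (s≤s z≤n)) (applyUpTo-cong k λ i i<k → h (suc i) (s≤s i<k))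

at-prefix : ∀ {p q} {g g′ : ℕ → Bool} j {k} → (∀ i → i < j → g′ i ≡ g i) →
  At p q 0 (applyUpTo (λ i → g (j + i)) k) (applyUpTo (λ i → g′ (j + i)) k) →
  At p q j (applyUpTo g (j + k)) (applyUpTo g′ (j + k))
at-prefix zero h a = a
at-prefix {g = g} (suc j) h a rewrite h 0 (s≤s z≤n) = there (at-prefix j (λ i i<j → h (suc i) (s≤s i<j)) a)

at-single : ∀ {g g′ : ℕ → Bool} j k → j < k → (∀ i → i < k → i ≢ j → g′ i ≡ g i) → g′ j ≡ true →
  At (g j ∷ []) (true ∷ []) j (applyUpTo g k) (applyUpTo g′ k)
-- Naming the length of the rest turns `k` into `j + suc r`, after which the common prefix can be
-- peeled off.
at-single {g} {g′} j k j<k same t with k ∸ suc j in eq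
... | r rewrite trans (sym (m+[n∸m]≡n j<k)) (trans (cong (suc j +_) eq) (sym (+-suc j r))) =
  at-prefix j (λ i i<j → same i (≤-trans i<j (m≤m+n j _)) (<⇒≢ i<j)) base
  where
  base : At (g j ∷ []) (true ∷ []) 0 (applyUpTo (λ i → g (j + i)) (suc r)) (applyUpTo (λ i → g′ (j + i)) (suc r))
  base rewrite +-identityʳ j | t
    | applyUpTo-cong {f = λ i → g′ (j + suc i)} {g = λ i → g (j + suc i)} r
        (λ i i<r → same (j + suc i) (+-monoʳ-< j (s≤s i<r)) (m+1+n≢m j)) = here

at-double : ∀ {g g′ : ℕ → Bool} j k → suc j < k → (∀ i → i < k → i ≢ j → i ≢ suc j → g′ i ≡ g i) →
  g′ j ≡ true → g′ (suc j) ≡ true →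
  At (g j ∷ g (suc j) ∷ []) (true ∷ true ∷ []) j (applyUpTo g k) (applyUpTo g′ k)
at-double {g} {g′} j k j<k same t₀ t₁ with k ∸ (2 + j) in eq
... | r rewrite trans (sym (m+[n∸m]≡n j<k))
    (trans (cong (2 + j +_) eq) (sym (trans (+-suc j (suc r)) (cong suc (+-suc j r))))) =
  at-prefix j (λ i i<j → same i (≤-trans i<j (m≤m+n j _)) (<⇒≢ i<j) (<⇒≢ (m≤n⇒m≤1+n i<j))) base
  where
  base : At (g j ∷ g (suc j) ∷ []) (true ∷ true ∷ []) 0
    (applyUpTo (λ i → g (j + i)) (2 + r)) (applyUpTo (λ i → g′ (j + i)) (2 + r))
  base rewrite +-identityʳ j | +-comm j 1 | t₀ | t₁
    | applyUpTo-cong {f = λ i → g′ (j + suc (suc i))} {g = λ i → g (j + suc (suc i))} r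
        (λ i i<r → same (j + suc (suc i)) (+-monoʳ-< j (s≤s (s≤s i<r))) (m+1+n≢m j)
          (λ e → m+1+n≢m j (suc-injective (trans (sym (+-suc j (suc i))) e)))) = here

at-triple : ∀ {g g′ : ℕ → Bool} j k → 2 + j < k → (∀ i → i < k → i ≢ j → i ≢ 2 + j → g′ i ≡ g i) →
  g j ≡ false → g (1 + j) ≡ false → g (2 + j) ≡ false → g′ j ≡ true → g′ (2 + j) ≡ true →
  At (false ∷ false ∷ false ∷ []) (true ∷ false ∷ true ∷ []) j (applyUpTo g k) (applyUpTo g′ k)
at-triple {g} {g′} j k j<k same f₀ f₁ f₂ t₀ t₂ with k ∸ (3 + j) in eq
... | r rewrite trans (sym (m+[n∸m]≡n j<k))
    (trans (cong (3 + j +_) eq) (sym (trans (+-suc j (2 + r)) (cong suc (trans (+-suc j (suc r)) (cong suc (+-suc j r))))))) =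
  at-prefix j (λ i i<j → same i (≤-trans i<j (m≤m+n j _)) (<⇒≢ i<j) (<⇒≢ (m≤n⇒m≤1+n (m≤n⇒m≤1+n i<j)))) base
  where
  f₁′ : g′ (suc j) ≡ false
  f₁′ = trans (same (suc j) (subst (_< j + (3 + r)) (+-comm j 1) (+-monoʳ-< j (s≤s (s≤s z≤n)))) 1+n≢n (λ e → 1+n≢n (sym e))) f₁
  base : At (false ∷ false ∷ false ∷ []) (true ∷ false ∷ true ∷ []) 0
    (applyUpTo (λ i → g (j + i)) (3 + r)) (applyUpTo (λ i → g′ (j + i)) (3 + r))
  base rewrite +-identityʳ j | +-comm j 1 | +-comm j 2 | f₀ | f₁ | f₂ | t₀ | t₂ | f₁′
    | applyUpTo-cong {f = λ i → g′ (j + suc (suc (suc i)))} {g = λ i → g (j + suc (suc (suc i)))} r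
        (λ i i<r → same (j + suc (suc (suc i))) (+-monoʳ-< j (s≤s (s≤s (s≤s i<r)))) (m+1+n≢m j)
          (λ e → m+1+n≢m j (suc-injective (suc-injective (trans (sym (trans (+-suc j (suc (suc i))) (cong suc (+-suc j (suc i))))) e))))) = here

at-index : ∀ {y q j k bs′} {g : ℕ → Bool} → At (false ∷ y ∷ []) q j (applyUpTo g k) bs′ →
  suc j < k × g j ≡ false
at-index {q = q} {g = g} a = go g a refl
  where
  go : ∀ {y j k bs bs′} (g : ℕ → Bool) → At (false ∷ y ∷ []) q j bs bs′ → bs ≡ applyUpTo g k →
    suc j < k × g j ≡ false
  go {k = suc (suc k)} g here e = s≤s (s≤s z≤n) , sym (cong head′ e)
    where
    head′ : List Bool → Bool
    head′ [] = true
    head′ (b ∷ _) = b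
  go {k = suc k} g (there a) e with go {k = k} (g ∘ suc) a (cong tail′ e)
    where
    tail′ : List Bool → List Bool
    tail′ [] = []
    tail′ (_ ∷ bs) = bs
  ... | j<k , f = s≤s j<k , f

-- The index determines the result, so a rewriting found by searching the list is the one caused by
-- the actual edge move at that index.
at-functional : ∀ {x y x′ y′ q₀ q₁ j bs bs₁ bs₂} → At (x ∷ y ∷ []) (q₀ ∷ q₁ ∷ []) j bs bs₁ →
  At (x′ ∷ y′ ∷ []) (q₀ ∷ q₁ ∷ []) j bs bs₂ → bs₁ ≡ bs₂
at-functional here here = refl
at-functional (there a) (there b) = cong (_ ∷_) (at-functional a b)

applyUpTo-endsTrue : ∀ {b} (g : ℕ → Bool) k → g k ≡ true → EndsTrue b (applyUpTo g (suc k))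
applyUpTo-endsTrue g zero t = t
applyUpTo-endsTrue g (suc k) t = applyUpTo-endsTrue {g 0} (g ∘ suc) k t

upper-pos : ∀ ℓ → 1 ≤ upper (suc ℓ)
upper-pos 0 = ≤-refl
upper-pos 1 = s≤s z≤n
upper-pos (suc (suc ℓ)) = s≤s z≤n

run-pos : ∀ ℓ bs → 1 ≤ scan upper (suc ℓ) bs
run-pos ℓ [] = upper-pos ℓ
run-pos ℓ (true ∷ bs) = ≤-trans (upper-pos ℓ) (m≤m+n (upper (suc ℓ)) _)
run-pos ℓ (false ∷ bs) = run-pos (suc ℓ) bs

false-pos : ∀ (g : ℕ → Bool) k i → i < k → g i ≡ false → ∀ ℓ → 1 ≤ scan upper ℓ (applyUpTo g k)
false-pos g (suc k) zero _ f ℓ rewrite f = run-pos ℓ (applyUpTo (g ∘ suc) k)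
false-pos g (suc k) (suc i) (s≤s i<k) f ℓ with g 0
... | true = ≤-trans (false-pos (g ∘ suc) k i i<k f 0) (m≤n+m _ (upper ℓ))
... | false = false-pos (g ∘ suc) k i i<k f (suc ℓ)

applyUpTo-run : ∀ (g : ℕ → Bool) j → (∀ i → i < j → g i ≡ false) → g j ≡ true →
  applyUpTo g (suc j) ≡ replicate j false ++ true ∷ []
applyUpTo-run g zero f t = cong (_∷ []) t
applyUpTo-run g (suc j) f t =
  cong₂ _∷_ (f 0 (s≤s z≤n)) (applyUpTo-run (g ∘ suc) j (λ i i<j → f (suc i) (s≤s i<j)) t)

scan-run : ∀ f ℓ j → scan f ℓ (replicate j false ++ true ∷ []) ≡ f (j + ℓ) + f 0
scan-run f ℓ zero = refl
scan-run f ℓ (suc j) = trans (scan-run f (suc ℓ) j) (cong (λ x → f x + f 0) (+-suc j ℓ))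

hasRes2-run : ∀ ℓ j → Res2 (j + ℓ) → HasRes2 ℓ (replicate j false ++ true ∷ [])
hasRes2-run ℓ zero r = inj₁ r
hasRes2-run ℓ (suc j) r = hasRes2-run (suc ℓ) j (subst Res2 (sym (+-suc j ℓ)) r)

onlyRes2-run : ∀ ℓ j → Res2 (j + ℓ) → OnlyRes2 ℓ (replicate j false ++ true ∷ [])
onlyRes2-run ℓ zero r = inj₂ r , inj₁ refl
onlyRes2-run ℓ (suc j) r = onlyRes2-run (suc ℓ) j (subst Res2 (sym (+-suc j ℓ)) r)

-- Boolean identities.

true⊎false : ∀ b → b ≡ true ⊎ b ≡ false
true⊎false true = inj₁ refl
true⊎false false = inj₂ refl

true≢false : ∀ {b} → b ≡ true → b ≡ false → ⊥
true≢false refl ()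

∨-false : ∀ {a b} → a ∨ b ≡ false → a ≡ false × b ≡ false
∨-false {false} h = refl , h

∨-true : ∀ {a b} → a ∨ b ≡ true → a ≡ true ⊎ b ≡ true
∨-true {true} _ = inj₁ refl
∨-true {false} h = inj₂ h

∨-introˡ : ∀ {a b} → a ≡ true → a ∨ b ≡ true
∨-introˡ refl = refl

∨-introʳ : ∀ a {b} → b ≡ true → a ∨ b ≡ true
∨-introʳ true _ = refl
∨-introʳ false h = h

¬true : ∀ {b} → (b ≡ true → ⊥) → b ≡ false
¬true {true} h = ⊥-elim (h refl)
¬true {false} h = refl

bool-ext : ∀ {p q} → (p ≡ true → q ≡ true) → (q ≡ true → p ≡ true) → p ≡ q
bool-ext {true} f g = sym (f refl)
bool-ext {false} {true} f g = g refl
bool-ext {false} {false} f g = refl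

-- Strategies in the game on an arbitrary graph

module Strategies {N : ℕ} (G : Graph N) where
  open Graph G
  open TotalDominationGame G

  private variable
    S S′ : VSet N

  infix 4 _⊑_
  -- Inclusion of dominated sets in contrapositive form, because legality is witnessed by
  -- undominated vertices.
  _⊑_ : VSet N → VSet N → Set
  S ⊑ S′ = ∀ x → S′ x ≡ false → S x ≡ false

  Legal : VSet N → Fin N → Set
  Legal S v = ∃[ x ] adj v x ≡ true × S x ≡ false

  legal-complete : ∀ {v} → Legal S v → T (legal S v)
  legal-complete {S} {v} (x , a , f) =
    any⁺ _ (lose (∈-allFin x) (Equivalence.from T-≡ (cong₂ (λ p q → p ∧ not q) a f)))

  legal-sound : ∀ {v} → T (legal S v) → Legal S v
  legal-sound {S} {v} h with find (any⁻ _ (allFin N) h)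
  ... | x , _ , t with adj v x in a | S x in f
  ... | true | false = x , a , f

  legal? : ∀ S v → Dec (Legal S v)
  legal? S v with T? (legal S v)
  ... | yes h = yes (legal-sound h)
  ... | no ¬h = no (¬h ∘ legal-complete)

  ⊑-move : ∀ v → S ⊑ S′ → afterMove S v ⊑ afterMove S′ v
  ⊑-move v h x e with ∨-false e
  ... | f , a = cong₂ _∨_ (h x f) a

  ⊑-after : ∀ {v} → S ⊑ afterMove S v
  ⊑-after x e = proj₁ (∨-false e)

  ⊑-illegal : ∀ {v} → S ⊑ S′ → ¬ Legal S′ v → afterMove S v ⊑ S′
  ⊑-illegal {S} {S′} {v} h ¬l x f with adj v x in a
  ... | true = ⊥-elim (¬l (x , a , f))
  ... | false = cong (_∨ false) (h x f)

  -- On Dominator's turn some legal move is demanded as well; otherwise a finished game would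
  -- satisfy the universal clause vacuously.
  AtLeast : ℕ → Player → VSet N → Set
  AtLeast zero _ _ = ⊤
  AtLeast (suc t) Dominator S = ∃ (Legal S) × (∀ v → Legal S v → AtLeast t Staller (afterMove S v))
  AtLeast (suc t) Staller S = ∃[ v ] Legal S v × AtLeast t Dominator (afterMove S v)

  AtMost : ℕ → Player → VSet N → Set
  AtMost zero _ S = ∀ v → ¬ Legal S v
  AtMost (suc t) Dominator S = (∀ v → ¬ Legal S v) ⊎ (∃[ v ] Legal S v × AtMost t Staller (afterMove S v))
  AtMost (suc t) Staller S = ∀ v → Legal S v → AtMost t Dominator (afterMove S v)

  legal-⊑ : ∀ {v} → S ⊑ S′ → Legal S′ v → Legal S v
  legal-⊑ h (x , a , f) = x , a , h x f

  -- Continuation principle: Staller follows her strategy for the larger set. A move of Dominator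
  -- that is illegal there stays below the larger set and counts as a pass, and a pass cannot hurt
  -- Staller, because any real move of Dominator would only have enlarged the set (`atLeast-skip`).
  atLeast-mono : ∀ t p → S ⊑ S′ → AtLeast t p S′ → AtLeast t p S
  atLeast-skip : ∀ t → AtLeast (suc t) Dominator S → AtLeast t Staller S
  atLeast-mono zero p h _ = tt
  atLeast-mono {S} {S′} (suc t) Dominator h l@((v₀ , l₀) , f) = (v₀ , legal-⊑ h l₀) , reply
    where
    reply : ∀ v → Legal S v → AtLeast t Staller (afterMove S v)
    reply v _ with legal? S′ v
    ... | yes lv = atLeast-mono t Staller (⊑-move v h) (f v lv)
    ... | no ¬lv = atLeast-mono t Staller (⊑-illegal h ¬lv) (atLeast-skip t l)
  atLeast-mono (suc t) Staller h (v , l , r) =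
    v , legal-⊑ h l , atLeast-mono t Dominator (⊑-move v h) r
  atLeast-skip t ((v , l) , f) = atLeast-mono t Staller ⊑-after (f v l)

  over-mono : S ⊑ S′ → (∀ v → ¬ Legal S v) → ∀ v → ¬ Legal S′ v
  over-mono h o v l = o v (legal-⊑ h l)

  over? : ∀ S → (∀ v → ¬ Legal S v) ⊎ ∃ (Legal S)
  over? S with Data.List.filterᵇ (legal S) (allFin N) in eq
  ... | [] = inj₁ λ v l → none v (subst (v ∈_) eq (∈-filter⁺ (T? ∘ legal S) (∈-allFin v) (legal-complete l)))
    where
    none : ∀ v → ¬ (v ∈ [])
    none v ()
  ... | v ∷ _ = inj₂ (v , legal-sound (proj₂ (∈-filter⁻ (T? ∘ legal S) {xs = allFin N}
                  (subst (v ∈_) (sym eq) (here refl)))))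

  -- Dominator follows his strategy for the smaller set. If the planned move has become illegal, its
  -- effect is already present, and any other legal move does at least as well (`atMost-pass`).
  atMost-mono : ∀ t p → S ⊑ S′ → AtMost t p S → AtMost t p S′
  atMost-pass : ∀ t → AtMost t Staller S → AtMost (suc t) Dominator S
  atMost-mono zero p h o = over-mono h o
  atMost-mono (suc t) Dominator h (inj₁ o) = inj₁ (over-mono h o)
  atMost-mono {S} {S′} (suc t) Dominator h (inj₂ (v , l , r)) with legal? S′ v
  ... | yes lv = inj₂ (v , lv , atMost-mono t Staller (⊑-move v h) r)
  ... | no ¬lv = atMost-pass t (atMost-mono t Staller (⊑-illegal h ¬lv) r)
  atMost-mono (suc t) Staller h r v l = atMost-mono t Dominator (⊑-move v h) (r v (legal-⊑ h l))
  atMost-pass {S} t r with over? S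
  ... | inj₁ o = inj₁ o
  ... | inj₂ (v , l) = inj₂ (v , l , atMost-mono t Staller ⊑-after r)

  -- A predominated vertex is worth at most two moves: Staller gains one by a move that dominates it
  -- only, and one more move may be needed when nothing else is left.
  module _ {s : Fin N} where

    Without : VSet N → VSet N → Set
    Without S S′ = S ⊑ S′ × (∀ x → x ≢ s → S x ≡ false → S′ x ≡ false) × S′ s ≡ true

    without-move : ∀ v → Without S S′ → Without (afterMove S v) (afterMove S′ v)
    without-move v (h , g , t) = ⊑-move v h , g′ , cong (_∨ adj v s) t
      where
      g′ : ∀ x → x ≢ s → _
      g′ x x≢s e with ∨-false e
      ... | f , a = cong₂ _∨_ (g x x≢s f) a

    spent : ∀ {v} → Without S S′ → adj v s ≡ true → S′ ⊑ afterMove S v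
    spent {v = v} (h , g , _) a x e with ∨-false e
    ... | f , b = g x (λ { refl → true≢false a b }) f

    -- With nothing left to dominate in `S′`, a legal move in `S` must dominate `s`, so it is the
    -- last one.
    finish : Without S S′ → (∀ v → ¬ Legal S′ v) → ∀ {v} → Legal S v → ∀ v′ → ¬ Legal (afterMove S v) v′
    finish W@(h , g , t) o {v} (x , a , f) with x Fin.≟ s
    ... | yes refl = over-mono (spent W a) o
    ... | no x≢s = ⊥-elim (o v (x , a , g x x≢s f))

    atMost-+2 : ∀ t p → Without S S′ → AtMost t p S′ → AtMost (2 + t) p S
    atMost-+2 {S} zero Dominator W o with over? S
    ... | inj₁ o′ = inj₁ o′
    ... | inj₂ (v , l) = inj₂ (v , l , λ v′ l′ → ⊥-elim (finish W o l v′ l′))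
    atMost-+2 zero Staller W o v l = inj₁ (finish W o l)
    atMost-+2 {S} (suc t) Dominator W (inj₁ o) with over? S
    ... | inj₁ o′ = inj₁ o′
    ... | inj₂ (v , l) = inj₂ (v , l , λ v′ l′ → ⊥-elim (finish W o l v′ l′))
    atMost-+2 (suc t) Dominator W (inj₂ (v , l , r)) =
      inj₂ (v , legal-⊑ (proj₁ W) l , atMost-+2 t Staller (without-move v W) r)
    atMost-+2 {S} {S′} (suc t) Staller W@(h , g , _) r v (x , a , f) with x Fin.≟ s
    ... | no x≢s = atMost-+2 t Dominator (without-move v W) (r v (x , a , g x x≢s f))
    -- The move dominates `s` and is the first extra one. The imagined game still waits for Staller
    -- while the real one waits for Dominator; `atMost-pass` repairs the turn at the price of the
    -- second extra move.
    ... | yes refl = atMost-mono (2 + t) Dominator (spent W a) (atMost-pass (suc t) r)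

  private
    best : Player → List ℕ → ℕ
    best p [] = 0
    best p (x ∷ xs) = suc (opt p x xs)

    moves : VSet N → List (Fin N)
    moves S = filterᵇ (legal S) (allFin N)

    value-step : ∀ k p S → value (suc k) p S ≡
      best p (map (λ v → value k (other p) (afterMove S v)) (moves S))
    value-step k p S with map (λ v → value k (other p) (afterMove S v)) (moves S)
    ... | [] = refl
    ... | _ ∷ _ = refl

    min≤ : ∀ x xs {y} → y ∈ x ∷ xs → foldr _⊓_ x xs ≤ y
    min≤ x [] (here refl) = ≤-refl
    min≤ x (z ∷ zs) (here refl) = ≤-trans (m⊓n≤n z _) (min≤ x zs (here refl))
    min≤ x (z ∷ zs) (there (here refl)) = m⊓n≤m z _
    min≤ x (z ∷ zs) (there (there i)) = ≤-trans (m⊓n≤n z _) (min≤ x zs (there i))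

    ≤max : ∀ x xs {y} → y ∈ x ∷ xs → y ≤ foldr _⊔_ x xs
    ≤max x [] (here refl) = ≤-refl
    ≤max x (z ∷ zs) (here refl) = ≤-trans (≤max x zs (here refl)) (m≤n⊔m z _)
    ≤max x (z ∷ zs) (there (here refl)) = m≤m⊔n z _
    ≤max x (z ∷ zs) (there (there i)) = ≤-trans (≤max x zs (there i)) (m≤n⊔m z _)

    ≤min : ∀ x xs {t} → (∀ {y} → y ∈ x ∷ xs → t ≤ y) → t ≤ foldr _⊓_ x xs
    ≤min x [] h = h (here refl)
    ≤min x (z ∷ zs) h = ⊓-glb (h (there (here refl)))
      (≤min x zs λ { (here e) → h (here e) ; (there i) → h (there (there i)) })

    max≤ : ∀ x xs {t} → (∀ {y} → y ∈ x ∷ xs → y ≤ t) → foldr _⊔_ x xs ≤ t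
    max≤ x [] h = h (here refl)
    max≤ x (z ∷ zs) h = ⊔-lub (h (there (here refl)))
      (max≤ x zs λ { (here e) → h (here e) ; (there i) → h (there (there i)) })

    best-D≤ : ∀ xs {y} → y ∈ xs → best Dominator xs ≤ suc y
    best-D≤ (x ∷ xs) i = s≤s (min≤ x xs i)

    best-S≥ : ∀ xs {y} → y ∈ xs → suc y ≤ best Staller xs
    best-S≥ (x ∷ xs) i = s≤s (≤max x xs i)

    best-D≥ : ∀ xs {t y} → y ∈ xs → (∀ {y} → y ∈ xs → t ≤ y) → suc t ≤ best Dominator xs
    best-D≥ (x ∷ xs) _ h = s≤s (≤min x xs h)

    best-S≤ : ∀ xs {t} → (∀ {y} → y ∈ xs → y ≤ t) → best Staller xs ≤ suc t
    best-S≤ [] h = z≤n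
    best-S≤ (x ∷ xs) h = s≤s (max≤ x xs h)

    best-over : ∀ p xs → (∀ {y} → ¬ y ∈ xs) → best p xs ≡ 0
    best-over p [] h = refl
    best-over p (x ∷ xs) h = ⊥-elim (h (here refl))

    ∈-moves : ∀ {v} → Legal S v → v ∈ moves S
    ∈-moves {S} {v} l = ∈-filter⁺ (T? ∘ legal S) (∈-allFin v) (legal-complete l)

    moves-∈ : ∀ {v} → v ∈ moves S → Legal S v
    moves-∈ {S} i = legal-sound (proj₂ (∈-filter⁻ (T? ∘ legal S) {xs = allFin N} i))

    value-over : ∀ k p {S} → (∀ v → ¬ Legal S v) → value k p S ≡ 0
    value-over zero p o = refl
    value-over (suc k) p {S} o rewrite value-step k p S =
      best-over p _ λ i → let v , j , _ = ∈-map⁻ _ i in o v (moves-∈ j)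

  -- Exhausted fuel yields the value 0, so a lower bound of `t` moves requires at least `t` units of
  -- fuel.
  atLeast-value : ∀ k t p S → t ≤ k → AtLeast t p S → t ≤ value k p S
  atLeast-value k zero p S _ _ = z≤n
  atLeast-value (suc k) (suc t) Dominator S (s≤s t≤k) ((v , l) , f)
    rewrite value-step k Dominator S = best-D≥ _ (∈-map⁺ _ (∈-moves l)) bound
    where
    bound : ∀ {y} → y ∈ _ → t ≤ y
    bound i with ∈-map⁻ (λ v → value k Staller (afterMove S v)) i
    ... | v , j , refl = atLeast-value k t Staller _ t≤k (f v (moves-∈ j))
  atLeast-value (suc k) (suc t) Staller S (s≤s t≤k) (v , l , r)
    rewrite value-step k Staller S =
    ≤-trans (s≤s (atLeast-value k t Dominator _ t≤k r)) (best-S≥ _ (∈-map⁺ _ (∈-moves l)))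

  atMost-value : ∀ k t p S → AtMost t p S → value k p S ≤ t
  atMost-value zero t p S _ = z≤n
  atMost-value (suc k) zero p S o = ≤-reflexive (value-over (suc k) p o)
  atMost-value (suc k) (suc t) Dominator S (inj₁ o) = ≤-trans (≤-reflexive (value-over (suc k) Dominator o)) z≤n
  atMost-value (suc k) (suc t) Dominator S (inj₂ (v , l , r))
    rewrite value-step k Dominator S =
    ≤-trans (best-D≤ _ (∈-map⁺ _ (∈-moves l))) (s≤s (atMost-value k t Staller _ r))
  atMost-value (suc k) (suc t) Staller S f
    rewrite value-step k Staller S = best-S≤ _ bound
    where
    bound : ∀ {y} → y ∈ _ → y ≤ t
    bound i with ∈-map⁻ (λ v → value k Dominator (afterMove S v)) i
    ... | v , j , refl = atMost-value k t Dominator _ (f v (moves-∈ j))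

-- The two sequences of targets in G_{n,m}

-- Multiplication by three in a form on which `lower`, `upper` and `Res2` compute.
triple : ℕ → ℕ
triple zero = 0
triple (suc k) = 3 + triple k

data Side : Set where
  A B : Side

opposite : Side → Side
opposite A = B
opposite B = A

-- An even cycle splits into two "sides": the vertices of one side are dominated by the vertices of the
-- other, so that vtx c is a cyclic sequence of L vertices of which edg c b covers the b-th and the next.
-- Indices are read modulo L.
record Layout (k′ : ℕ) {N : ℕ} (G : Graph N) : Set₁ where
  open Graph G
  L : ℕ
  L = 4 + triple k′
  field
    vtx edg : Side → ℕ → Fin N
    Hub Inner : Fin N → Set
  Clique : Fin N → Set
  Clique x = Hub x ⊎ Inner x
  field
    vtx-cong : ∀ c a b → a % L ≡ b % L → vtx c a ≡ vtx c b
    edg-cong : ∀ c a b → a % L ≡ b % L → edg c a ≡ edg c b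
    vertexView : ∀ x → (∃[ c ] ∃[ a ] x ≡ vtx c a) ⊎ Clique x
    moveView : ∀ x → (∃[ c ] ∃[ b ] x ≡ edg c b) ⊎ Clique x
    edge-covers : ∀ c a b → adj (edg c b) (vtx c a) ≡ true → a % L ≡ b % L ⊎ a % L ≡ suc b % L
    edge-left : ∀ c b → adj (edg c b) (vtx c b) ≡ true
    edge-right : ∀ c b → adj (edg c b) (vtx c (suc b)) ≡ true
    edge-cross : ∀ c b a → adj (edg c b) (vtx (opposite c) a) ≡ false
    edge-inner : ∀ c b {z} → Inner z → adj (edg c b) z ≡ false
    -- The hub vertices are w₁ and w₂; the targets 0 and 2 of side A are u₁ and u₅.
    hub-covers : ∀ {x} a → Hub x → adj x (vtx A a) ≡ true → a % L ≡ 0 ⊎ a % L ≡ 2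
    hub-0 : ∀ {x} → Hub x → adj x (vtx A 0) ≡ true
    hub-2 : ∀ {x} → Hub x → adj x (vtx A 2) ≡ true
    hub-B : ∀ {x} → Hub x → ∀ a → adj x (vtx B a) ≡ false
    inner-vtx : ∀ {z} → Inner z → ∀ c a → adj z (vtx c a) ≡ false
    clique-adj : ∀ {x y} → Clique x → Clique y → x ≢ y → adj x y ≡ true
    clique-irrefl : ∀ {x} → Clique x → adj x x ≡ false
    hub₁ inner₁ inner₂ : Fin N
    isHub₁ : Hub hub₁
    isInner₁ : Inner inner₁
    isInner₂ : Inner inner₂
    -- While one inner vertex is undominated, a different one must be available to dominate it
    -- without affecting the cycle.
    inner-distinct : inner₁ ≢ inner₂

-- The graph of the theorem as a layout.

≡ᵇ-sound : ∀ a b → (a ≡ᵇ b) ≡ true → a ≡ b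
≡ᵇ-sound a b h = ≡ᵇ⇒≡ a b (Equivalence.from T-≡ h)

≡ᵇ-complete : ∀ {a b} → a ≡ b → (a ≡ᵇ b) ≡ true
≡ᵇ-complete {a} {b} h = Equivalence.to T-≡ (≡⇒≡ᵇ a b h)

≡ᵇ-false : ∀ {a b} → a ≢ b → (a ≡ᵇ b) ≡ false
≡ᵇ-false {a} {b} h with a ≡ᵇ b in e
... | true = ⊥-elim (h (≡ᵇ-sound a b e))
... | false = refl

<ᵇ-true : ∀ {a b} → a < b → (a <ᵇ b) ≡ true
<ᵇ-true h = Equivalence.to T-≡ (<⇒<ᵇ h)

<ᵇ-false : ∀ {a b} → b ≤ a → (a <ᵇ b) ≡ false
<ᵇ-false {a} {b} h with a <ᵇ b in e
... | true = ⊥-elim (<⇒≱ (<ᵇ⇒< a b (Equivalence.from T-≡ e)) h)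
... | false = refl

∧-true : ∀ {a b} → a ∧ b ≡ true → a ≡ true × b ≡ true
∧-true {true} h = refl , h

odd≢even : ∀ a b → suc (a * 2) ≢ b * 2
odd≢even (suc a) (suc b) h = odd≢even a b (suc-injective (suc-injective h))

halve : ∀ x → ∃[ h ] (x ≡ h * 2 ⊎ x ≡ suc (h * 2))
halve zero = 0 , inj₁ refl
halve (suc zero) = 0 , inj₂ refl
halve (suc (suc x)) with halve x
... | h , inj₁ refl = suc h , inj₁ refl
... | h , inj₂ refl = suc h , inj₂ refl

suc-% : ∀ b L .{{_ : NonZero L}} → suc b % L ≡ suc (b % L) % L
suc-% b L = trans (%-distribˡ-+ 1 b L) (sym (trans (%-distribˡ-+ 1 (b % L) L)
  (cong (λ x → (1 % L + x) % L) (m%n%n≡m%n b L))))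

suc-%-injective : ∀ {a b} l → suc a % suc l ≡ suc b % suc l → a % suc l ≡ b % suc l
suc-%-injective {a} {b} l h = trans (sym (back a)) (trans (cong (λ x → (l + x) % suc l) h) (back b))
  where
  -- Adding `l` undoes the successor modulo `suc l`.
  back : ∀ a → (l + suc a % suc l) % suc l ≡ a % suc l
  back a = trans (%-distribˡ-+ l (suc a % suc l) (suc l))
    (trans (cong (λ x → (l % suc l + x) % suc l) (m%n%n≡m%n (suc a) (suc l)))
    (trans (sym (%-distribˡ-+ l (suc a) (suc l)))
    (trans (cong (_% suc l) (trans (+-suc l a) (cong suc (+-comm l a))))
    (trans (cong (_% suc l) (sym (+-suc a l))) ([m+n]%n≡m%n a (suc l))))))

module _ (k′ n m : ℕ) (n≡ : n ≡ (4 + triple k′) * 2) (4≤m : 4 ≤ m) where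
  private
    l L : ℕ
    l = 3 + triple k′
    L = suc l

    n∸1 : n ∸ 1 ≡ suc (l * 2)
    n∸1 rewrite n≡ = refl

    Adjacent : ℕ → ℕ → Set
    Adjacent a b = b ≡ suc a ⊎ a ≡ suc b ⊎ (a ≡ 0 × b ≡ suc (l * 2)) ⊎ (b ≡ 0 × a ≡ suc (l * 2))

    adj-sound : ∀ {a b} → a < n → b < n → adjℕ n a b ≡ true → Adjacent a b
    adj-sound {a} {b} a<n b<n h rewrite <ᵇ-true a<n | <ᵇ-true b<n | n∸1 with ∨-true {b ≡ᵇ suc a} h
    ... | inj₁ e = inj₁ (≡ᵇ-sound b _ e)
    ... | inj₂ h with ∨-true {a ≡ᵇ suc b} h
    ... | inj₁ e = inj₂ (inj₁ (≡ᵇ-sound a _ e))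
    ... | inj₂ h with ∨-true {(a ≡ᵇ 0) ∧ _} h
    ... | inj₁ e = let p , q = ∧-true {a ≡ᵇ 0} e in inj₂ (inj₂ (inj₁ (≡ᵇ-sound a _ p , ≡ᵇ-sound b _ q)))
    ... | inj₂ e = let p , q = ∧-true {b ≡ᵇ 0} e in inj₂ (inj₂ (inj₂ (≡ᵇ-sound b _ p , ≡ᵇ-sound a _ q)))

    adj-complete : ∀ {a b} → a < n → b < n → Adjacent a b → adjℕ n a b ≡ true
    adj-complete {a} {b} a<n b<n h rewrite <ᵇ-true a<n | <ᵇ-true b<n | n∸1 with h
    ... | inj₁ e = ∨-introˡ (≡ᵇ-complete {b} e)
    ... | inj₂ (inj₁ e) = ∨-introʳ (b ≡ᵇ suc a) (∨-introˡ (≡ᵇ-complete {a} e))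
    ... | inj₂ (inj₂ (inj₁ (p , q))) =
      ∨-introʳ (b ≡ᵇ suc a) (∨-introʳ (a ≡ᵇ suc b) (∨-introˡ (cong₂ _∧_ (≡ᵇ-complete {a} p) (≡ᵇ-complete {b} q))))
    ... | inj₂ (inj₂ (inj₂ (p , q))) =
      ∨-introʳ (b ≡ᵇ suc a) (∨-introʳ (a ≡ᵇ suc b) (∨-introʳ ((a ≡ᵇ 0) ∧ (b ≡ᵇ suc (l * 2)))
        (cong₂ _∧_ (≡ᵇ-complete {b} p) (≡ᵇ-complete {a} q))))

    Adjacent-sym : ∀ {a b} → Adjacent a b → Adjacent b a
    Adjacent-sym (inj₁ e) = inj₂ (inj₁ e)
    Adjacent-sym (inj₂ (inj₁ e)) = inj₁ e
    Adjacent-sym (inj₂ (inj₂ (inj₁ e))) = inj₂ (inj₂ (inj₂ e))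
    Adjacent-sym (inj₂ (inj₂ (inj₂ e))) = inj₂ (inj₂ (inj₁ e))

    next : ∀ b → b < L → suc b < L ⊎ b ≡ l
    next b b<L with m≤n⇒m<n∨m≡n (s≤s⁻¹ b<L)
    ... | inj₁ h = inj₁ (s≤s h)
    ... | inj₂ h = inj₂ h

    odd-even : ∀ a b → a < L → b < L → Adjacent (suc (b * 2)) (a * 2) → a ≡ b ⊎ a ≡ suc b % L
    odd-even a b a<L b<L (inj₁ e) with *-cancelʳ-≡ a (suc b) 2 e
    ... | refl = inj₂ (sym (m<n⇒m%n≡m a<L))
    odd-even a b a<L b<L (inj₂ (inj₁ e)) = inj₁ (*-cancelʳ-≡ a b 2 (sym (suc-injective e)))
    odd-even zero b a<L b<L (inj₂ (inj₂ (inj₂ (_ , q)))) with *-cancelʳ-≡ b l 2 (suc-injective q)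
    ... | refl = inj₂ (sym (n%n≡0 L))

    even-odd-left : ∀ b → Adjacent (suc (b * 2)) (b * 2)
    even-odd-left b = inj₂ (inj₁ refl)

    even-odd-right : ∀ b → b < L → Adjacent (suc (b * 2)) (suc b % L * 2)
    even-odd-right b b<L with next b b<L
    ... | inj₁ h rewrite m<n⇒m%n≡m h = inj₁ refl
    ... | inj₂ refl = subst (λ x → Adjacent (suc (l * 2)) (x * 2)) (sym (n%n≡0 L)) (inj₂ (inj₂ (inj₂ (refl , refl))))

    even-even : ∀ a b → Adjacent (a * 2) (b * 2) → ⊥
    even-even a b (inj₁ e) = odd≢even a b (sym e)
    even-even a b (inj₂ (inj₁ e)) = odd≢even b a (sym e)
    even-even a b (inj₂ (inj₂ (inj₁ (_ , e)))) = odd≢even l b (sym e)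
    even-even a b (inj₂ (inj₂ (inj₂ (_ , e)))) = odd≢even l a (sym e)

    odd-odd : ∀ a b → Adjacent (suc (a * 2)) (suc (b * 2)) → ⊥
    odd-odd a b (inj₁ e) = odd≢even a b (sym (suc-injective e))
    odd-odd a b (inj₂ (inj₁ e)) = odd≢even b a (sym (suc-injective e))
    odd-odd a b (inj₂ (inj₂ (inj₁ (() , _))))
    odd-odd a b (inj₂ (inj₂ (inj₂ (() , _))))

    position : Side → ℕ → ℕ
    position A a = a % L * 2
    position B a = suc (a % L * 2)

    even-< : ∀ {a} → a < L → suc (a * 2) < n
    even-< {a} a<L rewrite n≡ = *-monoˡ-≤ 2 a<L

    position-< : ∀ c a → position c a < n
    position-< A a = ≤-trans (n≤1+n _) (even-< (m%n<n a L))
    position-< B a = even-< (m%n<n a L)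

    vtx edg : Side → ℕ → Fin (n + m)
    vtx c a = fromℕ< (≤-trans (position-< c a) (m≤m+n n m))
    edg A b = vtx B b
    -- Between the odd vertices 2b + 1 and 2b + 3 lies the even vertex 2b + 2.
    edg B b = vtx A (suc b)

    toℕ-vtx : ∀ c a → toℕ (vtx c a) ≡ position c a
    toℕ-vtx c a = Fin.toℕ-fromℕ< _

    vtx-< : ∀ c a → toℕ (vtx c a) < n
    vtx-< c a rewrite toℕ-vtx c a = position-< c a

    open Graph (Gnm n m)

    vtx-adj→ : ∀ c a d b → adj (vtx c a) (vtx d b) ≡ true → Adjacent (position c a) (position d b)
    vtx-adj→ c a d b h = adj-sound (position-< c a) (position-< d b)
      (subst₂ (λ x y → adjℕ n x y ≡ true) (toℕ-vtx c a) (toℕ-vtx d b) h)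

    vtx-adj← : ∀ c a d b → Adjacent (position c a) (position d b) → adj (vtx c a) (vtx d b) ≡ true
    vtx-adj← c a d b h = subst₂ (λ x y → adjℕ n x y ≡ true) (sym (toℕ-vtx c a)) (sym (toℕ-vtx d b))
      (adj-complete (position-< c a) (position-< d b) h)

    vtx-cong : ∀ c a b → a % L ≡ b % L → vtx c a ≡ vtx c b
    vtx-cong A a b h = Fin.toℕ-injective (trans (toℕ-vtx A a) (trans (cong (_* 2) h) (sym (toℕ-vtx A b))))
    vtx-cong B a b h =
      Fin.toℕ-injective (trans (toℕ-vtx B a) (trans (cong (λ x → suc (x * 2)) h) (sym (toℕ-vtx B b))))

    suc-cong : ∀ {a b} → a % L ≡ b % L → suc a % L ≡ suc b % L
    suc-cong {a} {b} h = trans (suc-% a L) (trans (cong (λ x → suc x % L) h) (sym (suc-% b L)))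

    edg-cong : ∀ c a b → a % L ≡ b % L → edg c a ≡ edg c b
    edg-cong A a b h = vtx-cong B a b h
    edg-cong B a b h = vtx-cong A (suc a) (suc b) (suc-cong {a} {b} h)

    Hub Inner : Fin (n + m) → Set
    Hub x = toℕ x ≡ n ⊎ toℕ x ≡ suc n
    Inner x = 2 + n ≤ toℕ x

    cliqueView : ∀ x → n ≤ toℕ x → Hub x ⊎ Inner x
    cliqueView x h with m≤n⇒m<n∨m≡n h
    ... | inj₂ e = inj₁ (inj₁ (sym e))
    ... | inj₁ h with m≤n⇒m<n∨m≡n h
    ... | inj₂ e = inj₁ (inj₂ (sym e))
    ... | inj₁ h = inj₂ h

    cycleView : ∀ x → toℕ x < n → ∃[ c ] ∃[ a ] a < L × x ≡ vtx c a
    cycleView x x<n with halve (toℕ x)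
    ... | h , inj₁ e = A , h , h<L , Fin.toℕ-injective (trans e (sym (trans (toℕ-vtx A h) (cong (_* 2) (m<n⇒m%n≡m h<L)))))
      where
      h<L : h < L
      h<L = *-cancelʳ-< 2 h L (subst₂ _<_ e n≡ x<n)
    ... | h , inj₂ e = B , h , h<L ,
      Fin.toℕ-injective (trans e (sym (trans (toℕ-vtx B h) (cong (λ x → suc (x * 2)) (m<n⇒m%n≡m h<L)))))
      where
      h<L : h < L
      h<L = *-cancelʳ-< 2 h L (≤-trans (n≤1+n _) (subst₂ _<_ e n≡ x<n))

    vertexView : ∀ x → (∃[ c ] ∃[ a ] x ≡ vtx c a) ⊎ Hub x ⊎ Inner x
    vertexView x with <-≤-connex (toℕ x) n
    ... | inj₁ x<n = let c , a , _ , e = cycleView x x<n in inj₁ (c , a , e)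
    ... | inj₂ n≤x = inj₂ (cliqueView x n≤x)

    moveView : ∀ x → (∃[ c ] ∃[ b ] x ≡ edg c b) ⊎ Hub x ⊎ Inner x
    moveView x with <-≤-connex (toℕ x) n
    ... | inj₂ n≤x = inj₂ (cliqueView x n≤x)
    ... | inj₁ x<n with cycleView x x<n
    ... | B , a , _ , e = inj₁ (A , a , e)
    -- The vertex u₁ closes the cycle: it joins the last target of side B to the first.
    ... | A , zero , _ , e = inj₁ (B , l , trans e (vtx-cong A 0 L (sym (n%n≡0 L))))
    ... | A , suc a , _ , e = inj₁ (B , a , e)

    edge-covers : ∀ c a b → adj (edg c b) (vtx c a) ≡ true → a % L ≡ b % L ⊎ a % L ≡ suc b % L
    edge-covers A a b h with odd-even (a % L) (b % L) (m%n<n a L) (m%n<n b L) (vtx-adj→ B b A a h)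
    ... | inj₁ e = inj₁ e
    ... | inj₂ e = inj₂ (trans e (sym (suc-% b L)))
    edge-covers B a b h with odd-even (suc b % L) (a % L) (m%n<n (suc b) L) (m%n<n a L)
                                   (Adjacent-sym {suc b % L * 2} (vtx-adj→ A (suc b) B a h))
    ... | inj₁ e = inj₂ (sym e)
    ... | inj₂ e = inj₁ (sym (suc-%-injective {b} {a} l (trans e (sym (suc-% a L)))))

    edge-left : ∀ c b → adj (edg c b) (vtx c b) ≡ true
    edge-left A b = vtx-adj← B b A b (even-odd-left (b % L))
    edge-left B b = vtx-adj← A (suc b) B b (Adjacent-sym {suc (b % L * 2)}
      (subst (λ x → Adjacent (suc (b % L * 2)) (x * 2)) (sym (suc-% b L)) (even-odd-right (b % L) (m%n<n b L))))

    edge-right : ∀ c b → adj (edg c b) (vtx c (suc b)) ≡ true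
    edge-right A b = vtx-adj← B b A (suc b)
      (subst (λ x → Adjacent (suc (b % L * 2)) (x * 2)) (sym (suc-% b L)) (even-odd-right (b % L) (m%n<n b L)))
    edge-right B b = vtx-adj← A (suc b) B (suc b) (Adjacent-sym {suc (suc b % L * 2)} (even-odd-left (suc b % L)))

    edge-cross : ∀ c b a → adj (edg c b) (vtx (opposite c) a) ≡ false
    edge-cross A b a = ¬true λ h → odd-odd (b % L) (a % L) (vtx-adj→ B b B a h)
    edge-cross B b a = ¬true λ h → even-even (suc b % L) (a % L) (vtx-adj→ A (suc b) A a h)

    inner-not-hub : ∀ {z} → 2 + n ≤ z → (z ≡ᵇ n) ∨ (z ≡ᵇ suc n) ≡ false
    inner-not-hub {z} h = cong₂ _∨_ (≡ᵇ-false {z} λ { refl → 1+n≰n (≤-trans (n≤1+n _) h) })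
      (≡ᵇ-false {z} λ { refl → 1+n≰n h })

    adj-clique : ∀ {a b} → a < n → n ≤ b → adjℕ n a b ≡
      ((a ≡ᵇ 0) ∨ (a ≡ᵇ 4)) ∧ ((b ≡ᵇ n) ∨ (b ≡ᵇ suc n))
    adj-clique a<n n≤b rewrite <ᵇ-true a<n | <ᵇ-false n≤b = refl

    clique-adjˡ : ∀ {a b} → n ≤ a → b < n → adjℕ n a b ≡
      ((b ≡ᵇ 0) ∨ (b ≡ᵇ 4)) ∧ ((a ≡ᵇ n) ∨ (a ≡ᵇ suc n))
    clique-adjˡ n≤a b<n rewrite <ᵇ-false n≤a | <ᵇ-true b<n = refl

    clique-clique : ∀ {a b} → n ≤ a → n ≤ b → adjℕ n a b ≡ not (a ≡ᵇ b)
    clique-clique n≤a n≤b rewrite <ᵇ-false n≤a | <ᵇ-false n≤b = refl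

    ∧-falseʳ : ∀ a {b} → b ≡ false → a ∧ b ≡ false
    ∧-falseʳ true h = h
    ∧-falseʳ false h = refl

    n≤inner : ∀ {z} → 2 + n ≤ z → n ≤ z
    n≤inner h = ≤-trans (≤-trans (n≤1+n n) (n≤1+n _)) h

    vtx-inner : ∀ c a {z} → Inner z → adj (vtx c a) z ≡ false
    vtx-inner c a h = trans (adj-clique (vtx-< c a) (n≤inner h)) (∧-falseʳ _ (inner-not-hub h))

    edge-inner : ∀ c b {z} → Inner z → adj (edg c b) z ≡ false
    edge-inner A b = vtx-inner B b
    edge-inner B b = vtx-inner A (suc b)

    inner-vtx : ∀ {z} → Inner z → ∀ c a → adj z (vtx c a) ≡ false
    inner-vtx h c a = trans (clique-adjˡ (n≤inner h) (vtx-< c a)) (∧-falseʳ _ (inner-not-hub h))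

    n≤hub : ∀ {x} → Hub x → n ≤ toℕ x
    n≤hub (inj₁ e) = ≤-reflexive (sym e)
    n≤hub (inj₂ e) = ≤-trans (n≤1+n n) (≤-reflexive (sym e))

    isHub : ∀ {x} → Hub x → (toℕ x ≡ᵇ n) ∨ (toℕ x ≡ᵇ suc n) ≡ true
    isHub {x} (inj₁ e) = ∨-introˡ (≡ᵇ-complete e)
    isHub {x} (inj₂ e) = ∨-introʳ (toℕ x ≡ᵇ n) (≡ᵇ-complete e)

    hub-adj : ∀ {x} c a → Hub x → adj x (vtx c a) ≡ (position c a ≡ᵇ 0) ∨ (position c a ≡ᵇ 4)
    hub-adj {x} c a h = trans (clique-adjˡ (n≤hub h) (vtx-< c a))
      (trans (cong₂ _∧_ (cong (λ y → (y ≡ᵇ 0) ∨ (y ≡ᵇ 4)) (toℕ-vtx c a)) (isHub {x} h)) (∧-identityʳ _))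

    hub-covers : ∀ {x} a → Hub x → adj x (vtx A a) ≡ true → a % L ≡ 0 ⊎ a % L ≡ 2
    hub-covers {x} a h e with ∨-true {position A a ≡ᵇ 0} (trans (sym (hub-adj {x} A a h)) e)
    ... | inj₁ p = inj₁ (*-cancelʳ-≡ (a % L) 0 2 (≡ᵇ-sound (position A a) 0 p))
    ... | inj₂ p = inj₂ (*-cancelʳ-≡ (a % L) 2 2 (≡ᵇ-sound (position A a) 4 p))

    hub-B : ∀ {x} → Hub x → ∀ a → adj x (vtx B a) ≡ false
    hub-B {x} h a = trans (hub-adj {x} B a h) (≡ᵇ-false {position B a} {4} (odd≢even (a % L) 2))

    toClique : ∀ {x} → Hub x ⊎ Inner x → n ≤ toℕ x
    toClique (inj₁ h) = n≤hub h
    toClique (inj₂ h) = n≤inner h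

    mk : ∀ i → i < m → Fin (n + m)
    mk i h = fromℕ< (+-monoʳ-< n h)

    toℕ-mk : ∀ i (h : i < m) → toℕ (mk i h) ≡ n + i
    toℕ-mk i h = Fin.toℕ-fromℕ< _

    0<m : 0 < m
    0<m = ≤-trans (s≤s z≤n) 4≤m

    2<m : 2 < m
    2<m = ≤-trans (s≤s (s≤s (s≤s z≤n))) 4≤m

    mk-inner : ∀ i (h : i < m) → 2 ≤ i → Inner (mk i h)
    mk-inner i h 2≤i rewrite toℕ-mk i h = subst (_≤ n + i) (+-comm n 2) (+-monoʳ-≤ n 2≤i)

  w₁-vertex : Fin (n + m)
  w₁-vertex = mk 0 0<m

  toℕ-w₁ : toℕ w₁-vertex ≡ n
  toℕ-w₁ = trans (toℕ-mk 0 0<m) (+-identityʳ n)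

  layout : Layout k′ (Gnm n m)
  layout = record
    { vtx = vtx ; edg = edg ; Hub = Hub ; Inner = Inner
    ; vtx-cong = vtx-cong ; edg-cong = edg-cong ; vertexView = vertexView ; moveView = moveView
    ; edge-covers = edge-covers ; edge-left = edge-left ; edge-right = edge-right ; edge-cross = edge-cross
    ; edge-inner = λ c b {z} → edge-inner c b {z} ; hub-covers = λ {x} → hub-covers {x}
    ; hub-0 = λ {x} h → hub-adj {x} A 0 h ; hub-2 = λ {x} h → hub-adj {x} A 2 h ; hub-B = λ {x} → hub-B {x}
    ; inner-vtx = λ {z} → inner-vtx {z}
    ; clique-adj = λ {x} {y} h₁ h₂ x≢y → trans (clique-clique (toClique {x} h₁) (toClique {y} h₂))
        (cong not (≡ᵇ-false (x≢y ∘ Fin.toℕ-injective)))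
    ; clique-irrefl = λ {x} h → trans (clique-clique (toClique {x} h) (toClique {x} h))
        (cong not (≡ᵇ-complete {toℕ x} refl))
    ; hub₁ = w₁-vertex ; inner₁ = mk 2 2<m ; inner₂ = mk 3 4≤m
    ; isHub₁ = inj₁ toℕ-w₁ ; isInner₁ = mk-inner 2 2<m ≤-refl ; isInner₂ = mk-inner 3 4≤m (n≤1+n 2)
    ; inner-distinct = λ e → m+1+n≢m (n + 2) (sym (trans (trans (sym (toℕ-mk 2 2<m)) (cong toℕ e))
        (trans (toℕ-mk 3 4≤m) (sym (+-assoc n 2 1)))))
    }

-- Indices modulo L and the weights of the runs that occur.

%-cancel-+ : ∀ l a {i j} → (i + a) % suc l ≡ (j + a) % suc l → i % suc l ≡ j % suc l
%-cancel-+ l zero {i} {j} h = subst₂ (λ x y → x % suc l ≡ y % suc l) (+-identityʳ i) (+-identityʳ j) h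
%-cancel-+ l (suc a) {i} {j} h = %-cancel-+ l a {i} {j} (suc-%-injective {i + a} {j + a} l
  (subst₂ (λ x y → x % suc l ≡ y % suc l) (+-suc i a) (+-suc j a) h))

-- For a window one entry longer than the period: its two ends are the only distinct congruent
-- positions.
%-wrap : ∀ l {i j} → i ≤ suc l → j ≤ suc l → i % suc l ≡ j % suc l →
  i ≡ j ⊎ (i ≡ 0 × j ≡ suc l) ⊎ (i ≡ suc l × j ≡ 0)
%-wrap l i≤ j≤ h with m≤n⇒m<n∨m≡n i≤ | m≤n⇒m<n∨m≡n j≤
... | inj₁ i< | inj₁ j< = inj₁ (trans (sym (m<n⇒m%n≡m i<)) (trans h (m<n⇒m%n≡m j<)))
... | inj₁ i< | inj₂ refl = inj₂ (inj₁ (trans (sym (m<n⇒m%n≡m i<)) (trans h (n%n≡0 (suc l))) , refl))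
... | inj₂ refl | inj₁ j< = inj₂ (inj₂ (refl , trans (sym (m<n⇒m%n≡m j<)) (trans (sym h) (n%n≡0 (suc l)))))
... | inj₂ refl | inj₂ refl = inj₁ refl

%-locate : ∀ l a b → ∃[ j ] j < suc l × (j + a) % suc l ≡ b % suc l
%-locate l a b = (b + d) % L , m%n<n (b + d) L , eq
  where
  L d : ℕ
  L = suc l
  d = L ∸ a % L
  eq : ((b + d) % L + a) % L ≡ b % L
  eq = trans (%-distribˡ-+ ((b + d) % L) a L)
    (trans (cong (λ x → (x + a % L) % L) (m%n%n≡m%n (b + d) L))
    (trans (sym (%-distribˡ-+ (b + d) a L))
    (trans (cong (_% L) (trans (+-assoc b d a) (cong (b +_)
      (trans (cong (d +_) (m≡m%n+[m/n]*n a L)) (trans (sym (+-assoc d (a % L) _))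
        (cong (_+ a / L * L) (m∸n+n≡m (<⇒≤ (m%n<n a L)))))))))
    ([m+kn]%n≡m%n b (suc (a / L)) L))))

+-pos : ∀ a {b} → 1 ≤ a + b → 1 ≤ a ⊎ 1 ≤ b
+-pos zero h = inj₂ h
+-pos (suc a) h = inj₁ (s≤s z≤n)

lower-triple₁ : ∀ k → lower (1 + triple k) ≡ 1 + k * 2
lower-triple₁ zero = refl
lower-triple₁ (suc k) = cong (2 +_) (lower-triple₁ k)

lower-triple₂ : ∀ k → lower (2 + triple k) ≡ 1 + k * 2
lower-triple₂ zero = refl
lower-triple₂ (suc k) = cong (2 +_) (lower-triple₂ k)

upper-triple₁ : ∀ k → upper (1 + triple k) ≡ 1 + k * 2
upper-triple₁ zero = refl
upper-triple₁ (suc k) = cong (2 +_) (upper-triple₁ k)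

upper-triple₂ : ∀ k → upper (2 + triple k) ≡ 2 + k * 2
upper-triple₂ zero = refl
upper-triple₂ (suc k) = cong (2 +_) (upper-triple₂ k)

res2-triple : ∀ k → Res2 (2 + triple k)
res2-triple zero = tt
res2-triple (suc k) = res2-triple k

-- Positions of the two sequences during play.

module Play {k′ N : ℕ} {G : Graph N} (layout : Layout k′ G) where
  open Layout layout
  open Graph G
  open TotalDominationGame G using (afterMove)
  open Strategies G

  private
    l : ℕ
    l = 3 + triple k′

    variable
      S : VSet N

  -- The cyclic sequence is cut at index `a`. With L + 1 entries the target at the cut appears at
  -- both ends; if it is dominated, the cut breaks no run and every run is closed.
  bits : VSet N → Side → ℕ → List Bool
  bits S c a = applyUpTo (λ i → S (vtx c (i + a))) (suc L)

  low up : VSet N → Side → ℕ → ℕ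
  low S c a = scan lower 0 (bits S c a)
  up S c a = scan upper 0 (bits S c a)

  Root : VSet N → Side → ℕ → Set
  Root S c a = S (vtx c a) ≡ true

  Fresh : VSet N → Side → Set
  Fresh S c = ∀ a → S (vtx c a) ≡ false

  Untouched : Fin N → Side → Set
  Untouched v c = ∀ a → adj v (vtx c a) ≡ false

  Done : VSet N → Set
  Done S = ∀ x → Clique x → S x ≡ true

  done-after : ∀ v → Done S → Done (afterMove S v)
  done-after v d x c = ∨-introˡ (d x c)

  root-after : ∀ v {c a} → Root S c a → Root (afterMove S v) c a
  root-after v r = ∨-introˡ r

  root-end : ∀ {c} a → Root S c a → Root S c (L + a)
  root-end {S} {c} a r = trans (cong S (vtx-cong c (L + a) a (trans (cong (_% L) (+-comm L a)) ([m+n]%n≡m%n a L)))) r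

  bits-endsTrue : ∀ {b} c a → Root S c a → EndsTrue b (bits S c a)
  bits-endsTrue {S} {b} c a r = applyUpTo-endsTrue {b} (λ i → S (vtx c (i + a))) L (root-end {S} a r)

  bits-untouched : ∀ {v} c a → Untouched v c → bits (afterMove S v) c a ≡ bits S c a
  bits-untouched {S} c a h = applyUpTo-cong (suc L) λ i _ →
    trans (cong (S (vtx c (i + a)) ∨_) (h (i + a))) (∨-identityʳ _)

  fresh-untouched : ∀ {v c} → Untouched v c → Fresh S c → Fresh (afterMove S v) c
  fresh-untouched h f a = cong₂ _∨_ (f a) (h a)

  module _ {c a} (r : Root S c a) where

    -- An edge at the border of the window also reaches the other copy of the cut target. That entry
    -- is `true` already, so nothing but the pair at `j` changes.
    edge-at : ∀ j → j < L →
      At (S (vtx c (j + a)) ∷ S (vtx c (suc (j + a))) ∷ []) (true ∷ true ∷ []) j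
         (bits S c a) (bits (afterMove S (edg c (j + a))) c a)
    edge-at j j<L = at-double j (suc L) (s≤s j<L) same
      (∨-introʳ (S (vtx c (j + a))) (edge-left c (j + a)))
      (∨-introʳ (S (vtx c (suc (j + a)))) (edge-right c (j + a)))
      where
      e : Fin N
      e = edg c (j + a)
      atEnd : ∀ i → i ≡ 0 ⊎ i ≡ L → S (vtx c (i + a)) ≡ true
      atEnd i (inj₁ refl) = r
      atEnd i (inj₂ refl) = root-end {S} a r
      same : ∀ i → i < suc L → i ≢ j → i ≢ suc j → S (vtx c (i + a)) ∨ adj e (vtx c (i + a)) ≡ S (vtx c (i + a))
      same i i≤L i≢j i≢sj with adj e (vtx c (i + a)) in q
      ... | false = ∨-identityʳ _
      ... | true = trans (∨-zeroʳ _) (sym (atEnd i ends))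
        where
        ends : i ≡ 0 ⊎ i ≡ L
        ends with edge-covers c (i + a) (j + a) q
        ... | inj₁ h with %-wrap l (s≤s⁻¹ i≤L) (<⇒≤ j<L) (%-cancel-+ l a {i} {j} h)
        ... | inj₁ p = ⊥-elim (i≢j p)
        ... | inj₂ (inj₁ (p , _)) = inj₁ p
        ... | inj₂ (inj₂ (p , _)) = inj₂ p
        ends | inj₂ h with %-wrap l (s≤s⁻¹ i≤L) j<L (%-cancel-+ l a {i} {suc j} h)
        ... | inj₁ p = ⊥-elim (i≢sj p)
        ... | inj₂ (inj₁ (p , _)) = inj₁ p
        ... | inj₂ (inj₂ (p , _)) = inj₂ p

    edge-at-any : ∀ b → ∃[ j ] ∃[ x ] ∃[ y ] At (x ∷ y ∷ []) (true ∷ true ∷ []) j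
      (bits S c a) (bits (afterMove S (edg c b)) c a) × x ≡ S (vtx c b) × y ≡ S (vtx c (suc b))
    edge-at-any b with %-locate l a b
    ... | j , j<L , h = j , _ , _ ,
      subst (λ e → At _ _ j (bits S c a) (bits (afterMove S e) c a)) (edg-cong c (j + a) b h) (edge-at j j<L) ,
      cong S (vtx-cong c (j + a) b h) ,
      cong S (vtx-cong c (suc (j + a)) (suc b)
        (trans (suc-% (j + a) L) (trans (cong (λ x → suc x % L) h) (sym (suc-% b L)))))

    edge-move-drop : ∀ b → Drop (low S c a) (low (afterMove S (edg c b)) c a) (HasRes2 0 (bits (afterMove S (edg c b)) c a))
    edge-move-drop b = let _ , _ , _ , m , _ = edge-at-any b in edge-drop m

    play : ∀ {P} → EdgeChoice (bits S c a) P → ∃[ b ] Legal S (edg c b) × P (bits (afterMove S (edg c b)) c a)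
    play {P} (y , j , bs′ , m , p) with at-index {k = suc L} {g = λ i → S (vtx c (i + a))} m
    ... | s≤s j<L , f = j + a , (vtx c (j + a) , edge-left c (j + a) , f) ,
      subst P (at-functional m (edge-at j j<L)) p

  -- The position of a sequence just after its entry by one edge. Only one side is mentioned, so
  -- moves that do not touch this side preserve it.
  NearEdge : VSet N → Side → ℕ → Set
  NearEdge S c b = ∀ a → S (vtx c a) ≡ adj (edg c b) (vtx c a)

  NearHub : VSet N → Set
  NearHub S = ∀ a → S (vtx A a) ≡ adj hub₁ (vtx A a)

  nearEdge-root : ∀ {c b} → NearEdge S c b → Root S c b
  nearEdge-root {c = c} {b} h = trans (h b) (edge-left c b)

  nearEdge-bits : ∀ {c b} → NearEdge S c b →
    bits S c b ≡ true ∷ true ∷ replicate (2 + triple k′) false ++ true ∷ []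
  nearEdge-bits {S} {c} {b} h = cong₂ _∷_ (nearEdge-root {S} h) (cong₂ _∷_ (trans (h (suc b)) (edge-right c b))
    (applyUpTo-run (λ i → S (vtx c (2 + i + b))) (2 + triple k′) far (root-end {S} b (nearEdge-root {S} h))))
    where
    far : ∀ i → i < 2 + triple k′ → S (vtx c (2 + i + b)) ≡ false
    far i i< = trans (h (2 + i + b)) (¬true λ e → covered (edge-covers c (2 + i + b) b e))
      where
      i≤ : 2 + i < L
      i≤ = s≤s (s≤s i<)
      covered : (2 + i + b) % L ≡ b % L ⊎ (2 + i + b) % L ≡ suc b % L → ⊥
      covered (inj₁ e) with trans (sym (m<n⇒m%n≡m i≤)) (%-cancel-+ l b {2 + i} {0} e)
      ... | ()
      covered (inj₂ e) with trans (sym (m<n⇒m%n≡m i≤)) (%-cancel-+ l b {2 + i} {1} e)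
      ... | ()

  nearHub-bits : NearHub S → bits S A 0 ≡ true ∷ false ∷ true ∷ replicate (1 + triple k′) false ++ true ∷ []
  nearHub-bits {S} h = cong₂ _∷_ root (cong₂ _∷_ (away 1 (s≤s (s≤s z≤n)) (λ ()) (λ ()))
    (cong₂ _∷_ (trans (h 2) (hub-2 isHub₁))
      (applyUpTo-run (λ i → S (vtx A (3 + i + 0))) (1 + triple k′)
        (λ i i< → away (3 + i) (s≤s (s≤s (s≤s i<))) (λ ()) (λ ())) (root-end {S} 0 root))))
    where
    root : Root S A 0
    root = trans (h 0) (hub-0 isHub₁)
    away : ∀ i → i < L → i ≢ 0 → i ≢ 2 → S (vtx A (i + 0)) ≡ false
    away i i< i≢0 i≢2 rewrite +-identityʳ i = trans (h i) (¬true λ e →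
      [ (λ p → i≢0 (trans (sym (m<n⇒m%n≡m i<)) p)) , (λ p → i≢2 (trans (sym (m<n⇒m%n≡m i<)) p)) ]′
        (hub-covers i isHub₁ e))

  -- `P` is by computation `suc k′ * 2`, so bounds stated with `q * 2` apply to it at `q` =
  -- `suc k′`.
  p P : ℕ
  p = k′ * 2
  P = 2 + p

  nearEdge-low : ∀ {c b} → NearEdge S c b → low S c b ≡ 1 + p
  nearEdge-low {S} h = trans (cong (scan lower 0) (nearEdge-bits {S} h))
    (trans (scan-run lower 0 (2 + triple k′)) (trans (+-identityʳ _)
      (trans (cong lower (+-identityʳ (2 + triple k′))) (lower-triple₂ k′))))

  nearEdge-up : ∀ {c b} → NearEdge S c b → up S c b ≡ P
  nearEdge-up {S} h = trans (cong (scan upper 0) (nearEdge-bits {S} h))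
    (trans (scan-run upper 0 (2 + triple k′)) (trans (+-identityʳ _)
      (trans (cong upper (+-identityʳ (2 + triple k′))) (upper-triple₂ k′))))

  nearEdge-res2 : ∀ {c b} → NearEdge S c b → HasRes2 0 (bits S c b)
  nearEdge-res2 {S} h = subst (HasRes2 0) (sym (nearEdge-bits {S} h))
    (inj₂ (inj₂ (hasRes2-run 0 (2 + triple k′) (subst Res2 (sym (+-identityʳ (2 + triple k′))) (res2-triple k′)))))

  nearEdge-onlyRes2 : ∀ {c b} → NearEdge S c b → OnlyRes2 0 (bits S c b)
  nearEdge-onlyRes2 {S} h = subst (OnlyRes2 0) (sym (nearEdge-bits {S} h))
    (inj₁ refl , inj₁ refl ,
      onlyRes2-run 0 (2 + triple k′) (subst Res2 (sym (+-identityʳ (2 + triple k′))) (res2-triple k′)))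

  nearHub-low : NearHub S → low S A 0 ≡ P
  nearHub-low {S} h = trans (cong (scan lower 0) (nearHub-bits {S} h)) (cong suc
    (trans (scan-run lower 0 (1 + triple k′)) (trans (+-identityʳ _)
      (trans (cong lower (+-identityʳ (1 + triple k′))) (lower-triple₁ k′)))))

  nearHub-up : NearHub S → up S A 0 ≡ P
  nearHub-up {S} h = trans (cong (scan upper 0) (nearHub-bits {S} h)) (cong suc
    (trans (scan-run upper 0 (1 + triple k′)) (trans (+-identityʳ _)
      (trans (cong upper (+-identityʳ (1 + triple k′))) (upper-triple₁ k′)))))

  fresh-nearEdge : ∀ {c} b → Fresh S c → NearEdge (afterMove S (edg c b)) c b
  fresh-nearEdge {c = c} b f a = cong (_∨ adj (edg c b) (vtx c a)) (f a)

  fresh-legal : ∀ {c} b → Fresh S c → Legal S (edg c b)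
  fresh-legal {c = c} b f = vtx c b , edge-left c b , f b

  -- A hub vertex covers vtx A 0 and vtx A 2; if both are uncovered then so is the vertex between them.
  Guarded : VSet N → Set
  Guarded S = S (vtx A 1) ≡ true → S (vtx A 0) ≡ true ⊎ S (vtx A 2) ≡ true

  -- Among the edges only 0-1 and 1-2 reach target 1, and their other ends are the targets 0 and 2.
  covers-guarded : ∀ v → Guarded (adj v)
  covers-guarded v e with moveView v
  ... | inj₂ (inj₁ h) = inj₁ (hub-0 h)
  ... | inj₂ (inj₂ i) = ⊥-elim (true≢false e (inner-vtx i A 1))
  ... | inj₁ (B , b , refl) = ⊥-elim (true≢false e (edge-cross B b 1))
  ... | inj₁ (A , b , refl) with edge-covers A 1 b e
  ... | inj₁ q = inj₂ (trans (cong (adj (edg A b)) (vtx-cong A 2 (suc b)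
    (trans (suc-% 1 L) (trans (cong (λ x → suc x % L) q) (sym (suc-% b L)))))) (edge-right A b))
  ... | inj₂ q = inj₁ (trans (cong (adj (edg A b)) (vtx-cong A 0 b (suc-%-injective {0} {b} l q))) (edge-left A b))

  guarded-after : ∀ v → Guarded S → Guarded (afterMove S v)
  guarded-after {S} v g e with ∨-true {S (vtx A 1)} e
  ... | inj₁ h = ⊎-map ∨-introˡ ∨-introˡ (g h)
  ... | inj₂ h = ⊎-map (∨-introʳ (S (vtx A 0))) (∨-introʳ (S (vtx A 2))) (covers-guarded v h)

  module _ {a} (r : Root S A a) {x} (hx : Hub x) where
    private
      S⁺ : VSet N
      S⁺ = afterMove S x

      at-end : ∀ {i j} → i ≤ L → j < L → i ≢ j → (i + a) % L ≡ (j + a) % L → S (vtx A (i + a)) ≡ true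
      at-end {i} {j} i≤ j< i≢j h with %-wrap l i≤ (<⇒≤ j<) (%-cancel-+ l a {i} {j} h)
      ... | inj₁ e = ⊥-elim (i≢j e)
      ... | inj₂ (inj₁ (refl , _)) = r
      ... | inj₂ (inj₂ (refl , _)) = root-end {S} a r

      -- Here `s` is the target that may be new and `t` the one dominated before.
      single : ∀ s t → (∀ i → adj x (vtx A i) ≡ true → i % L ≡ s % L ⊎ i % L ≡ t % L) →
        adj x (vtx A s) ≡ true → S (vtx A t) ≡ true → low S A a ≤ suc (low S⁺ A a)
      single s t cov xs St with %-locate l a s
      ... | j , j<L , h = single-drop (at-single j (suc L) (m≤n⇒m≤1+n j<L) same
        (∨-introʳ (S (vtx A (j + a))) (trans (cong (adj x) (vtx-cong A (j + a) s h)) xs)))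
        where
        same : ∀ i → i < suc L → i ≢ j → S⁺ (vtx A (i + a)) ≡ S (vtx A (i + a))
        same i i≤ i≢j with adj x (vtx A (i + a)) in e
        ... | false = ∨-identityʳ _
        ... | true with cov (i + a) e
        ... | inj₁ q = trans (∨-zeroʳ _) (sym (at-end (s≤s⁻¹ i≤) j<L i≢j (trans q (sym h))))
        ... | inj₂ q = trans (∨-zeroʳ _) (sym (trans (cong S (vtx-cong A (i + a) t q)) St))

    hub-drop : Guarded S → Drop (low S A a) (low S⁺ A a) (HasRes2 0 (bits S⁺ A a))
    hub-drop g with true⊎false (S (vtx A 0)) | true⊎false (S (vtx A 2))
    ... | inj₁ S0 | _ = inj₁ (single 2 0 (λ i e → [ inj₂ , inj₁ ]′ (hub-covers i hx e)) (hub-2 hx) S0)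
    ... | inj₂ _ | inj₁ S2 = inj₁ (single 0 2 (λ i e → hub-covers i hx e) (hub-0 hx) S2)
    ... | inj₂ S0 | inj₂ S2 with %-locate l a 0
    ... | j , j<L , h = double-drop (at-triple j (suc L) (s≤s 2+j≤L) same
      (trans (cong S e0) S0) (trans (cong S e1) S1) (trans (cong S e2) S2)
      (∨-introʳ (S (vtx A (j + a))) (trans (cong (adj x) e0) (hub-0 hx)))
      (∨-introʳ (S (vtx A (2 + j + a))) (trans (cong (adj x) e2) (hub-2 hx))))
      where
      S1 : S (vtx A 1) ≡ false
      S1 = ¬true λ e → [ (λ t → true≢false t S0) , (λ t → true≢false t S2) ]′ (g e)
      h1 : (1 + j + a) % L ≡ 1 % L
      h1 = trans (suc-% (j + a) L) (cong (λ y → suc y % L) h)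
      h2 : (2 + j + a) % L ≡ 2 % L
      h2 = trans (suc-% (1 + j + a) L) (cong (λ y → suc y % L) h1)
      e0 = vtx-cong A (j + a) 0 h
      e1 = vtx-cong A (1 + j + a) 1 h1
      e2 = vtx-cong A (2 + j + a) 2 h2
      -- The targets 0, 1, 2 are consecutive in the window: if target 1 were at its right end, it
      -- would be the dominated root.
      2+j≤L : 2 + j ≤ L
      2+j≤L with m≤n⇒m<n∨m≡n j<L
      ... | inj₁ q = q
      ... | inj₂ q = ⊥-elim (true≢false
        (trans (cong (λ y → S (vtx A (y + a))) q) (root-end {S} a r)) (trans (cong S e1) S1))
      same : ∀ i → i < suc L → i ≢ j → i ≢ 2 + j → S⁺ (vtx A (i + a)) ≡ S (vtx A (i + a))
      same i i≤ i≢j i≢2+j with adj x (vtx A (i + a)) in e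
      ... | false = ∨-identityʳ _
      ... | true with hub-covers (i + a) hx e
      ... | inj₁ q = trans (∨-zeroʳ _) (sym (at-end (s≤s⁻¹ i≤) j<L i≢j (trans q (sym h))))
      ... | inj₂ q with %-wrap l (s≤s⁻¹ i≤) 2+j≤L (%-cancel-+ l a {i} {2 + j} (trans q (sym h2)))
      ... | inj₁ z = ⊥-elim (i≢2+j z)
      ... | inj₂ (inj₁ (refl , _)) = trans (∨-zeroʳ _) (sym r)
      ... | inj₂ (inj₂ (refl , _)) = trans (∨-zeroʳ _) (sym (root-end {S} a r))

-- Lower bounds

module Lower {k′ N : ℕ} {G : Graph N} (layout : Layout k′ G) where
  open Layout layout
  open Graph G
  open TotalDominationGame G using (afterMove)
  open Strategies G
  open Play layout

  private
    variable
      S : VSet N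

  record Open (c : Side) (S : VSet N) (a b : ℕ) : Set where
    constructor mkOpen
    field
      root : Root S c a
      root′ : Root S (opposite c) b
      guarded : Guarded S

  record Half (c : Side) (S : VSet N) (a : ℕ) : Set where
    constructor mkHalf
    field
      root : Root S c a
      fresh : Fresh S (opposite c)
      guarded : Guarded S

  total : Side → VSet N → ℕ → ℕ → ℕ
  total c S a b = low S c a + low S (opposite c) b

  AnyRes2 : Side → VSet N → ℕ → ℕ → Set
  AnyRes2 c S a b = HasRes2 0 (bits S c a) ⊎ HasRes2 0 (bits S (opposite c) b)

  open-after : ∀ v {c a b} → Open c S a b → Open c (afterMove S v) a b
  open-after {S} v (mkOpen r r′ g) = mkOpen (root-after {S} v r) (root-after {S} v r′) (guarded-after {S} v g)

  low-untouched : ∀ {v} c a → Untouched v c → low (afterMove S v) c a ≡ low S c a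
  low-untouched {S} c a h = cong (scan lower 0) (bits-untouched {S} c a h)

  edge-uncross : ∀ c b → Untouched (edg (opposite c) b) c
  edge-uncross A = edge-cross B
  edge-uncross B = edge-cross A

  untouched-drop : ∀ {v} c a → Untouched v c →
    Drop (low S c a) (low (afterMove S v) c a) (HasRes2 0 (bits (afterMove S v) c a))
  untouched-drop {S} c a h = inj₁ (≤-trans (≤-reflexive (sym (low-untouched {S} c a h))) (n≤1+n _))

  drop-left : ∀ {a a′ b b′ : ℕ} {R R′ : Set} → b ≡ b′ → Drop a a′ R → Drop (a + b) (a′ + b′) (R ⊎ R′)
  drop-left {b = b} refl h = weaken drop-comparison inj₁ (shiftʳ drop-comparison b h)

  drop-right : ∀ {a a′ b b′ : ℕ} {R R′ : Set} → a ≡ a′ → Drop b b′ R′ → Drop (a + b) (a′ + b′) (R ⊎ R′)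
  drop-right {a} refl h = weaken drop-comparison inj₂ (shift drop-comparison a h)

  open-drop : ∀ v {a b} → Open A S a b →
    Drop (total A S a b) (total A (afterMove S v) a b) (AnyRes2 A (afterMove S v) a b)
  open-drop {S} v {a} {b} (mkOpen r r′ g) with moveView v
  ... | inj₁ (A , e , refl) =
    drop-left (sym (low-untouched {S} B b (edge-cross A e))) (edge-move-drop {S} r e)
  ... | inj₁ (B , e , refl) =
    drop-right (sym (low-untouched {S} A a (edge-cross B e))) (edge-move-drop {S} r′ e)
  ... | inj₂ (inj₁ h) = drop-left (sym (low-untouched {S} B b (hub-B h))) (hub-drop {S} r h g)
  ... | inj₂ (inj₂ i) = drop-left (sym (low-untouched {S} B b (inner-vtx i B)))
    (untouched-drop {S} A a (inner-vtx i A))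

  private
    -- After a drop of two the total is one short, but the new run of residue 2 gives Staller a move
    -- that costs nothing. Hence `open-S-res2` may start one above the total.
    open-D : ∀ t S a b → Open A S a b → t ≤ total A S a b → AtLeast t Dominator S
    open-S : ∀ t S a b → Open A S a b → t ≤ total A S a b → AtLeast t Staller S
    open-S-res2 : ∀ t S a b → Open A S a b → AnyRes2 A S a b → t ≤ suc (total A S a b) → AtLeast t Staller S
    unit-move : ∀ {a b} → Open A S a b → 1 ≤ total A S a b →
      ∃[ v ] Legal S v × total A S a b ≤ suc (total A (afterMove S v) a b)

    unit-move {S} {a} {b} (mkOpen r r′ _) h with +-pos (low S A a) h
    ... | inj₁ h = let e , l , d = play {S} r (lower-unit-move (bits S A a) (bits-endsTrue {S} {true} A a r) h) in
      edg A e , l , subst (λ y → low S A a + low S B b ≤ suc (low (afterMove S (edg A e)) A a + y))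
        (sym (low-untouched {S} B b (edge-cross A e))) (+-monoˡ-≤ (low S B b) d)
    ... | inj₂ h = let e , l , d = play {S} r′ (lower-unit-move (bits S B b) (bits-endsTrue {S} {true} B b r′) h) in
      edg B e , l , subst (λ y → low S A a + low S B b ≤ suc (y + low (afterMove S (edg B e)) B b))
        (sym (low-untouched {S} A a (edge-cross B e))) (≤suc-shift (low S A a) d)

    open-D zero S a b s h = tt
    open-D (suc t) S a b s h with unit-move {S} s (≤-trans (s≤s z≤n) h)
    ... | v₀ , l₀ , _ = (v₀ , l₀) , reply
      where
      reply : ∀ v → Legal S v → AtLeast t Staller (afterMove S v)
      reply v _ with open-drop {S} v s
      ... | inj₁ d = open-S t _ a b (open-after {S} v s) (s≤s⁻¹ (≤-trans h d))
      ... | inj₂ (ρ , d) = open-S-res2 t _ a b (open-after {S} v s) ρ (s≤s⁻¹ (≤-trans h d))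

    open-S zero S a b s h = tt
    open-S (suc t) S a b s h with unit-move {S} s (≤-trans (s≤s z≤n) h)
    ... | v , l , d = v , l , open-D t _ a b (open-after {S} v s) (s≤s⁻¹ (≤-trans h d))

    open-S-res2 zero S a b s ρ h = tt
    open-S-res2 (suc t) S a b s@(mkOpen r r′ g) (inj₁ ρ) h =
      let e , l , d = play {S} r (lower-free-move (bits S A a) (bits-endsTrue {S} {true} A a r) ρ) in
      edg A e , l , open-D t _ a b (open-after {S} (edg A e) s)
        (≤-trans (s≤s⁻¹ h) (+-mono-≤ d (≤-reflexive (sym (low-untouched {S} B b (edge-cross A e))))))
    open-S-res2 (suc t) S a b s@(mkOpen r r′ g) (inj₂ ρ) h =
      let e , l , d = play {S} r′ (lower-free-move (bits S B b) (bits-endsTrue {S} {true} B b r′) ρ) in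
      edg B e , l , open-D t _ a b (open-after {S} (edg B e) s)
        (≤-trans (s≤s⁻¹ h) (+-mono-≤ (≤-reflexive (sym (low-untouched {S} A a (edge-cross B e)))) d))

  swap-open : ∀ {a b} → Open B S a b → Open A S b a
  swap-open (mkOpen r r′ g) = mkOpen r′ r g

  openD : ∀ c t S a b → Open c S a b → t ≤ total c S a b → AtLeast t Dominator S
  openD A t S a b s h = open-D t S a b s h
  openD B t S a b s h = open-D t S b a (swap-open s) (subst (t ≤_) (+-comm (low S B a) _) h)

  openS : ∀ c t S a b → Open c S a b → t ≤ total c S a b → AtLeast t Staller S
  openS A t S a b s h = open-S t S a b s h
  openS B t S a b s h = open-S t S b a (swap-open s) (subst (t ≤_) (+-comm (low S B a) _) h)

  openS-res2 : ∀ c t S a b → Open c S a b → AnyRes2 c S a b → t ≤ suc (total c S a b) → AtLeast t Staller S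
  openS-res2 A t S a b s ρ h = open-S-res2 t S a b s ρ h
  openS-res2 B t S a b s ρ h = open-S-res2 t S b a (swap-open s) ([ inj₂ , inj₁ ]′ ρ)
    (subst (λ y → t ≤ suc y) (+-comm (low S B a) _) h)

  -- Either the fresh sequence stays fresh, or it is entered by an edge, or by a hub vertex. Hub
  -- vertices have targets on side A only, whence `c ≡ B` in the last case.
  data Outcome (c : Side) (S S⁺ : VSet N) (a : ℕ) : Set where
    stays : Half c S⁺ a → Drop (low S c a) (low S⁺ c a) (HasRes2 0 (bits S⁺ c a)) → Outcome c S S⁺ a
    byEdge : ∀ b → Open c S⁺ a b → low S⁺ c a ≡ low S c a → NearEdge S⁺ (opposite c) b → Outcome c S S⁺ a
    byHub : c ≡ B → Open c S⁺ a 0 → low S⁺ c a ≡ low S c a → low S⁺ (opposite c) 0 ≡ P → Outcome c S S⁺ a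

  hub-same : ∀ {x y} → Hub x → Hub y → ∀ a → adj x (vtx A a) ≡ true → adj y (vtx A a) ≡ true
  hub-same {y = y} hx hy a e with hub-covers a hx e
  ... | inj₁ q = trans (cong (adj y) (vtx-cong A a 0 q)) (hub-0 hy)
  ... | inj₂ q = trans (cong (adj y) (vtx-cong A a 2 q)) (hub-2 hy)

  fresh-nearHub : ∀ {x} → Hub x → Fresh S A → NearHub (afterMove S x)
  fresh-nearHub hx f a = trans (cong (_∨ adj _ (vtx A a)) (f a))
    (bool-ext (hub-same hx isHub₁ a) (hub-same isHub₁ hx a))

  edge-outcome : ∀ c e {a} → Half c S a → Outcome c S (afterMove S (edg (opposite c) e)) a
  edge-outcome {S} c e {a} (mkHalf r f g) = byEdge e
    (mkOpen (root-after {S} _ r) (nearEdge-root {afterMove S (edg (opposite c) e)} near) (guarded-after {S} _ g))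
    (low-untouched {S} c a (edge-uncross c e)) near
    where
    near : NearEdge (afterMove S (edg (opposite c) e)) (opposite c) e
    near = fresh-nearEdge {S} e f

  untouched-outcome : ∀ v c {a} → Untouched v (opposite c) → Half c S a →
    Drop (low S c a) (low (afterMove S v) c a) (HasRes2 0 (bits (afterMove S v) c a)) → Outcome c S (afterMove S v) a
  untouched-outcome {S} v c u (mkHalf r f g) d =
    stays (mkHalf (root-after {S} v r) (fresh-untouched {S} {v} {opposite c} u f) (guarded-after {S} v g)) d

  outcome : ∀ v c {a} → Half c S a → Outcome c S (afterMove S v) a
  outcome {S} v c {a} s@(mkHalf r f g) with moveView v
  outcome {S} v A s@(mkHalf r f g) | inj₁ (A , e , refl) =
    untouched-outcome {S} v A (edge-cross A e) s (edge-move-drop {S} r e)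
  outcome {S} v A s | inj₁ (B , e , refl) = edge-outcome {S} A e s
  outcome {S} v B s | inj₁ (A , e , refl) = edge-outcome {S} B e s
  outcome {S} v B s@(mkHalf r f g) | inj₁ (B , e , refl) =
    untouched-outcome {S} v B (edge-cross B e) s (edge-move-drop {S} r e)
  outcome {S} v A s@(mkHalf r f g) | inj₂ (inj₁ h) = untouched-outcome {S} v A (hub-B h) s (hub-drop {S} r h g)
  outcome {S} v B {a} s@(mkHalf r f g) | inj₂ (inj₁ h) = byHub refl
    (mkOpen (root-after {S} v r) (∨-introʳ (S (vtx A 0)) (hub-0 h)) (guarded-after {S} v g))
    (low-untouched {S} B a (hub-B h)) (nearHub-low {afterMove S v} (fresh-nearHub {S} h f))
  outcome {S} v c {a} s | inj₂ (inj₂ i) =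
    untouched-outcome {S} v c (inner-vtx i (opposite c)) s (untouched-drop {S} c a (inner-vtx i c))

  half-edge : ∀ c e {a} → Half c S a → Half c (afterMove S (edg c e)) a
  half-edge {S} c e (mkHalf r f g) = mkHalf (root-after {S} _ r)
    (fresh-untouched {S} {edg c e} {opposite c} (edge-cross c e) f) (guarded-after {S} _ g)

  -- The player who has to enter the fresh sequence loses a move, and who that is depends on the parity of the
  -- weight of the other sequence; hence the bounds in steps of two.
  half-D : ∀ q c S a → Half c S a → q * 2 ≤ low S c a → AtLeast (suc (q * 2 + P)) Dominator S
  half-S : ∀ q c S a → Half c S a → q * 2 ≤ suc (low S c a) → AtLeast (q * 2 + P) Staller S
  half-S-res2 : ∀ q c S a → Half c S a → HasRes2 0 (bits S c a) → q * 2 ≤ low S c a →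
    AtLeast (2 + (q * 2 + P)) Staller S

  half-D q c S a s h = (edg (opposite c) 0 , fresh-legal {S} 0 (Half.fresh s)) , reply
    where
    reply : ∀ v → Legal S v → AtLeast (q * 2 + P) Staller (afterMove S v)
    reply v _ with outcome {S} v c s
    ... | stays s⁺ (inj₁ d) = half-S q c _ a s⁺ (≤-trans h d)
    ... | stays s⁺ (inj₂ (ρ , d)) = jump q h
      where
      jump : ∀ q → q * 2 ≤ low S c a → AtLeast (q * 2 + P) Staller (afterMove S v)
      -- With q = 0 nothing is claimed from the sequence already entered, so a drop of two there
      -- does no harm.
      jump zero h = half-S zero c _ a s⁺ z≤n
      jump (suc q) h = half-S-res2 q c _ a s⁺ ρ (s≤s⁻¹ (s≤s⁻¹ (≤-trans h d)))
    -- An entry by an edge leaves weight P - 1, and the run of residue 2 it creates restores the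
    -- missing unit.
    ... | byEdge b o same near = openS-res2 c (q * 2 + P) _ a b o (inj₂ (nearEdge-res2 {afterMove S v} near))
      (subst (q * 2 + P ≤_) (+-suc _ _) (+-mono-≤ (subst (q * 2 ≤_) (sym same) h)
        (≤-reflexive (cong suc (sym (nearEdge-low {afterMove S v} near))))))
    ... | byHub refl o same w = openS B (q * 2 + P) _ a 0 o
      (+-mono-≤ (subst (q * 2 ≤_) (sym same) h) (≤-reflexive (sym w)))

  -- Staller enters the fresh sequence herself; her own move makes up for the remaining weight P -
  -- 1.
  half-S zero c S a s h = v , fresh-legal {S} 0 (Half.fresh s) , openD c (1 + p) _ a 0
    (mkOpen (root-after {S} v (Half.root s)) (nearEdge-root {afterMove S v} near) (guarded-after {S} v (Half.guarded s)))
    (≤-trans (≤-reflexive (sym (nearEdge-low {afterMove S v} near))) (m≤n+m _ (low (afterMove S v) c a)))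
    where
    v : Fin N
    v = edg (opposite c) 0
    near : NearEdge (afterMove S v) (opposite c) 0
    near = fresh-nearEdge {S} 0 (Half.fresh s)
  half-S (suc q) c S a s h =
    let e , l , d = play {S} (Half.root s)
          (lower-unit-move (bits S c a) (bits-endsTrue {S} {true} c a (Half.root s)) (≤-trans (s≤s z≤n) (s≤s⁻¹ h))) in
    edg c e , l , half-D q c _ a (half-edge {S} c e s) (s≤s⁻¹ (≤-trans (s≤s⁻¹ h) d))
  half-S-res2 q c S a s ρ h =
    let e , l , d = play {S} (Half.root s) (lower-free-move (bits S c a) (bits-endsTrue {S} {true} c a (Half.root s)) ρ) in
    edg c e , l , half-D q c _ a (half-edge {S} c e s) (≤-trans h d)

-- Lower bounds with an undominated clique vertex in reserve.

module Token {k′ N : ℕ} {G : Graph N} (layout : Layout k′ G) where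
  open Layout layout
  open Graph G
  open TotalDominationGame G using (afterMove)
  open Strategies G
  open Play layout
  open Lower layout

  private
    variable
      S : VSet N

  otherInner : ∀ v → ∃[ z ] Inner z × z ≢ v
  otherInner v with inner₁ Fin.≟ v
  ... | no h = inner₁ , isInner₁ , h
  ... | yes refl = inner₂ , isInner₂ , λ e → inner-distinct (sym e)

  -- While z is undominated, any other inner vertex is a spare move for Staller: it leaves both sequences alone.
  record Pending (z : Fin N) (S : VSet N) : Set where
    constructor mkPending
    field
      inner : Inner z
      undominated : S z ≡ false

  pending-edge : ∀ c e {z} → Pending z S → Pending z (afterMove S (edg c e))
  pending-edge c e (mkPending i o) = mkPending i (cong₂ _∨_ o (edge-inner c e i))

  cash : ∀ {z} t → Pending z S → (∀ v → Inner v → AtLeast t Dominator (afterMove S v)) → AtLeast (suc t) Staller S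
  cash {z = z} t (mkPending i o) next with otherInner z
  ... | v , j , v≢z = v , (z , clique-adj (inj₂ j) (inj₂ i) v≢z , o) , next v j

  cash-open : ∀ {z} t a b → Pending z S → Open A S a b → t ≤ suc (total A S a b) → AtLeast t Staller S
  cash-open zero a b p s h = tt
  cash-open {S} (suc t) a b p s h = cash t p λ v i → openD A t _ a b (open-after {S} v s)
    (subst (t ≤_) (cong₂ _+_ (sym (low-untouched {S} A a (inner-vtx i A))) (sym (low-untouched {S} B b (inner-vtx i B))))
      (s≤s⁻¹ h))

  cash-half : ∀ {z} c q a → Pending z S → Half c S a → q * 2 ≤ low S c a → AtLeast (2 + (q * 2 + P)) Staller S
  cash-half {S} c q a p s h = cash (suc (q * 2 + P)) p next
    where
    next : ∀ v → Inner v → AtLeast (suc (q * 2 + P)) Dominator (afterMove S v)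
    next v i = half-D q c _ a (mkHalf (root-after {S} v (Half.root s))
      (fresh-untouched {S} {v} {opposite c} (inner-vtx i (opposite c)) (Half.fresh s)) (guarded-after {S} v (Half.guarded s)))
      (subst (q * 2 ≤_) (sym (low-untouched {S} c a (inner-vtx i c))) h)

  near-guarded : ∀ {b} → NearEdge S A b → Guarded S
  near-guarded {b = b} near e = ⊎-map (trans (near 0)) (trans (near 2)) (covers-guarded (edg A b) (trans (sym (near 1)) e))

  near-untouched : ∀ {v c b} → Untouched v c → NearEdge S c b → NearEdge (afterMove S v) c b
  near-untouched {S} {c = c} u near a = trans (cong (S (vtx c a) ∨_) (u a)) (trans (∨-identityʳ _) (near a))

  -- The only nonempty run has residue 2, so the next edge on this side cannot cost two.
  near-edge-drop : ∀ {c b} e → NearEdge S c b → 1 + p ≤ suc (low (afterMove S (edg c e)) c b)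
  near-edge-drop {S} {c} {b} e near =
    let _ , _ , _ , m , _ = edge-at-any {S} {c} {b} (nearEdge-root {S} near) e in
    ≤-trans (≤-reflexive (sym (nearEdge-low {S} near))) (edge-drop-onlyRes2 m 0 (nearEdge-onlyRes2 {S} near))

  -- Playing the edge b and then a hub vertex is the same as playing them in the other order.
  near-hub : ∀ {b x} → NearEdge S A b → Hub x →
    1 + p ≤ low (afterMove S x) A 0 ⊎ HasRes2 0 (bits (afterMove S x) A 0) × p ≤ low (afterMove S x) A 0
  near-hub {S} {b} {x} near hx = ⊎-map s≤s⁻¹ (λ (ρ , h) → ρ , s≤s⁻¹ (s≤s⁻¹ h))
    (subst₂ (λ n bs → Drop n (scan lower 0 bs) (HasRes2 0 bs)) (nearHub-low {adj x} near₀) same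
      (edge-move-drop {adj x} {A} {0} (hub-0 hx) b))
    where
    near₀ : NearHub (adj x)
    near₀ a = bool-ext (hub-same hx isHub₁ a) (hub-same isHub₁ hx a)
    same : bits (afterMove (adj x) (edg A b)) A 0 ≡ bits (afterMove S x) A 0
    same = applyUpTo-cong (suc L) λ i _ → trans (∨-comm (adj x (vtx A (i + 0))) _)
      (cong (_∨ adj x (vtx A (i + 0))) (sym (near (i + 0))))

  -- The vertex `z` is worth one move beyond the total. Staller cashes it after a drop of one; after
  -- a drop of two on side B she answers with a free move there and keeps it. If Dominator dominates
  -- `z` by a clique vertex, the weights make up for the loss: an inner vertex changes none, and a
  -- hub vertex has the cost found in `near-hub`. For the latter, side A is kept exactly as its
  -- entry left it.
  pending-D : ∀ t S z e b → Pending z S → NearEdge S A e → Root S B b → t ≤ suc (1 + p + low S B b) →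
    AtLeast t Dominator S
  pending-D zero S z e b π near r h = tt
  pending-D (suc t) S z e b π near r h = (_ , proj₁ (proj₂ legal)) , reply
    where
    state : Open A S e b
    state = mkOpen (nearEdge-root {S} near) r (near-guarded {S} near)
    legal : ∃[ v ] Legal S v × Inner v
    legal with otherInner z
    ... | v , j , v≢z = v , (z , clique-adj (inj₂ j) (inj₂ (Pending.inner π)) v≢z , Pending.undominated π) , j
    t≤ : t ≤ 1 + p + low S B b
    t≤ = s≤s⁻¹ h
    reply : ∀ v → Legal S v → AtLeast t Staller (afterMove S v)
    reply v _ with moveView v
    ... | inj₁ (A , e′ , refl) = cash-open t e b (pending-edge A e′ π) (open-after {S} v state)
      (≤-trans t≤ (+-mono-≤ (near-edge-drop {S} e′ near) (≤-reflexive (sym (low-untouched {S} B b (edge-cross A e′))))))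
    ... | inj₁ (B , e′ , refl) with edge-move-drop {S} {B} {b} r e′
    ... | inj₁ d = cash-open t e b (pending-edge B e′ π) (open-after {S} v state)
      (≤-trans t≤ (subst (1 + p + low S B b ≤_) (+-suc _ _)
        (+-mono-≤ (≤-reflexive (sym (nearEdge-low {afterMove S v} (near-untouched {S} (edge-cross B e′) near)))) d)))
    ... | inj₂ (ρ , d) = answer t h
      where
      S⁺ : VSet N
      S⁺ = afterMove S v
      r⁺ : Root S⁺ B b
      r⁺ = root-after {S} v r
      answer : ∀ t → suc t ≤ suc (1 + p + low S B b) → AtLeast t Staller S⁺
      answer zero _ = tt
      answer (suc t) h =
        let e″ , l , f = play {S⁺} r⁺ (lower-free-move (bits S⁺ B b) (bits-endsTrue {S⁺} {true} B b r⁺) ρ) in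
        edg B e″ , l , pending-D t _ z e b (pending-edge B e″ (pending-edge B e′ π))
          (near-untouched {S⁺} (edge-cross B e″) (near-untouched {S} (edge-cross B e′) near))
          (root-after {S⁺} (edg B e″) r⁺)
          (s≤s⁻¹ (≤-trans (s≤s⁻¹ h) (subst (1 + p + low S B b ≤_)
            (trans (+-suc (1 + p) _) (cong suc (+-suc (1 + p) _))) (+-monoʳ-≤ (1 + p) (≤-trans d (s≤s (s≤s f)))))))
    reply v _ | inj₂ (inj₁ x) with near-hub {S} near x
    ... | inj₁ d = openS A t _ 0 b hubState
      (≤-trans t≤ (+-mono-≤ d (≤-reflexive (sym (low-untouched {S} B b (hub-B x))))))
      where
      hubState : Open A (afterMove S v) 0 b
      hubState = mkOpen (∨-introʳ (S (vtx A 0)) (hub-0 x)) (root-after {S} v r) (guarded-after {S} v (near-guarded {S} near))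
    ... | inj₂ (ρ , d) = openS-res2 A t _ 0 b
      (mkOpen (∨-introʳ (S (vtx A 0)) (hub-0 x)) (root-after {S} v r) (guarded-after {S} v (near-guarded {S} near)))
      (inj₁ ρ) (≤-trans t≤ (s≤s (+-mono-≤ d (≤-reflexive (sym (low-untouched {S} B b (hub-B x)))))))
    reply v _ | inj₂ (inj₂ i) = openS A t _ e b (open-after {S} v state) (≤-trans t≤ (+-mono-≤
      (≤-reflexive (trans (sym (nearEdge-low {S} near)) (sym (low-untouched {S} A e (inner-vtx i A)))))
      (≤-reflexive (sym (low-untouched {S} B b (inner-vtx i B))))))

  cash-legal : ∀ {z} → Pending z S → ∃ (Legal S)
  cash-legal {z = z} (mkPending i o) with otherInner z
  ... | v , j , v≢z = v , z , clique-adj (inj₂ j) (inj₂ i) v≢z , o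

  -- Both sequences hold a run of residue 2. The free move is made on side B, since side A has to
  -- keep its form for `pending-D`.
  pending-near-S : ∀ {z a b} → Pending z S → NearEdge S A a → NearEdge S B b → AtLeast (P + P) Staller S
  pending-near-S {S} {z} {a} {b} π near near′ =
    let r = nearEdge-root {S} near′
        e , l , d = play {S} r (lower-free-move (bits S B b) (bits-endsTrue {S} {true} B b r) (nearEdge-res2 {S} near′))
    in edg B e , l , pending-D (suc (p + P)) _ z a b (pending-edge B e π) (near-untouched {S} (edge-cross B e) near)
      (root-after {S} (edg B e) r)
      (s≤s (subst (_≤ suc (p + low (afterMove S (edg B e)) B b)) (sym (+-suc p (suc p)))
        (s≤s (+-monoʳ-≤ p (≤-trans (≤-reflexive (sym (nearEdge-low {S} near′))) d)))))

  -- Each move of Dominator leaves Staller P + P: an edge on A is answered by cashing `z`, an edge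
  -- on B leads to `pending-near-S`, a hub vertex is paid for by `near-hub`, and an inner vertex
  -- leaves the run of residue 2 on A for a free move.
  pending-A : ∀ {z a} → Pending z S → NearEdge S A a → Fresh S B → AtLeast (suc (P + P)) Dominator S
  pending-A {S} {z} {a} π near f = cash-legal π , reply
    where
    half : Half A S a
    half = mkHalf (nearEdge-root {S} near) f (near-guarded {S} near)
    half⁺ : ∀ v → Untouched v B → Half A (afterMove S v) a
    half⁺ v u = mkHalf (root-after {S} v (Half.root half)) (fresh-untouched {S} {v} {B} u f)
      (guarded-after {S} v (Half.guarded half))
    reply : ∀ v → Legal S v → AtLeast (P + P) Staller (afterMove S v)
    reply v _ with moveView v
    ... | inj₁ (A , e , refl) =
      cash-half A k′ a (pending-edge A e π) (half⁺ v (edge-cross A e)) (s≤s⁻¹ (near-edge-drop {S} e near))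
    ... | inj₁ (B , e , refl) =
      pending-near-S (pending-edge B e π) (near-untouched {S} (edge-cross B e) near) (fresh-nearEdge {S} e f)
    ... | inj₂ (inj₁ h) with near-hub {S} near h
    ... | inj₁ d = half-S (suc k′) A _ 0 half₀ (s≤s d)
      where
      half₀ : Half A (afterMove S v) 0
      half₀ = mkHalf (∨-introʳ (S (vtx A 0)) (hub-0 h)) (fresh-untouched {S} {v} {B} (hub-B h) f)
        (guarded-after {S} v (Half.guarded half))
    ... | inj₂ (ρ , d) = half-S-res2 k′ A _ 0 (mkHalf (∨-introʳ (S (vtx A 0)) (hub-0 h))
      (fresh-untouched {S} {v} {B} (hub-B h) f) (guarded-after {S} v (Half.guarded half))) ρ d
    reply v _ | inj₂ (inj₂ i) = half-S-res2 k′ A _ a (half⁺ v (inner-vtx i B))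
      (nearEdge-res2 {afterMove S v} near⁺) (≤-trans (n≤1+n p) (≤-reflexive (sym (nearEdge-low {afterMove S v} near⁺))))
      where
      near⁺ : NearEdge (afterMove S v) A a
      near⁺ = near-untouched {S} (inner-vtx i A) near

  -- The contrast to `pending-A` is the hub move: it enters the fresh side A and leaves weight P
  -- there, while the run of residue 2 on side B still grants a free move.
  pending-B : ∀ {z b} → Pending z S → NearEdge S B b → Fresh S A → AtLeast (suc (P + P)) Dominator S
  pending-B {S} {z} {b} π near f = cash-legal π , reply
    where
    half : Half B S b
    half = mkHalf (nearEdge-root {S} near) f (λ e → ⊥-elim (true≢false e (f 1)))
    half⁺ : ∀ v → Untouched v A → Half B (afterMove S v) b
    half⁺ v u = mkHalf (root-after {S} v (Half.root half)) (fresh-untouched {S} {v} {A} u f)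
      (guarded-after {S} v (Half.guarded half))
    reply : ∀ v → Legal S v → AtLeast (P + P) Staller (afterMove S v)
    reply v _ with moveView v
    ... | inj₁ (A , e , refl) =
      pending-near-S (pending-edge A e π) (fresh-nearEdge {S} e f) (near-untouched {S} (edge-cross A e) near)
    ... | inj₁ (B , e , refl) =
      cash-half B k′ b (pending-edge B e π) (half⁺ v (edge-cross B e)) (s≤s⁻¹ (near-edge-drop {S} e near))
    ... | inj₂ (inj₁ h) = openS-res2 A (P + P) _ 0 b
      (mkOpen (∨-introʳ (S (vtx A 0)) (hub-0 h)) (root-after {S} v (Half.root half)) (guarded-after {S} v (Half.guarded half)))
      (inj₂ (nearEdge-res2 {afterMove S v} near⁺))
      (subst (P + P ≤_) (+-suc _ _) (+-mono-≤ (≤-reflexive (sym (nearHub-low {afterMove S v} (fresh-nearHub {S} h f))))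
        (s≤s (≤-reflexive (sym (nearEdge-low {afterMove S v} near⁺))))))
      where
      near⁺ : NearEdge (afterMove S v) B b
      near⁺ = near-untouched {S} (hub-B h) near
    ... | inj₂ (inj₂ i) = half-S-res2 k′ B _ b (half⁺ v (inner-vtx i A))
      (nearEdge-res2 {afterMove S v} near⁺) (≤-trans (n≤1+n p) (≤-reflexive (sym (nearEdge-low {afterMove S v} near⁺))))
      where
      near⁺ : NearEdge (afterMove S v) B b
      near⁺ = near-untouched {S} (inner-vtx i B) near

  opened-D : ∀ S → NearHub S → Fresh S B → AtLeast (suc (P + P)) Dominator S
  opened-D S near f = half-D (suc k′) A S 0 (mkHalf (trans (near 0) (hub-0 isHub₁)) f guard)
    (≤-reflexive (sym (nearHub-low {S} near)))
    where
    guard : Guarded S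
    guard e = inj₁ (trans (near 0) (hub-0 isHub₁))

  -- The clique together with the two cycle vertices attached to it.
  opened : VSet N
  opened = afterMove (afterMove ∅ hub₁) inner₁

  opened-nearHub : NearHub opened
  opened-nearHub a = trans (cong (adj hub₁ (vtx A a) ∨_) (inner-vtx isInner₁ A a)) (∨-identityʳ _)

  opened-fresh : Fresh opened B
  opened-fresh a = cong₂ _∨_ (hub-B isHub₁ a) (inner-vtx isInner₁ B a)

  hub≢inner : ∀ {x z} → Hub x → Inner z → x ≢ z
  hub≢inner h i refl = true≢false (hub-0 h) (inner-vtx i A 0)

  opened-done : Done opened
  opened-done x k with x Fin.≟ hub₁
  ... | yes refl = ∨-introʳ (adj hub₁ hub₁) (clique-adj (inj₂ isInner₁) k (λ e → hub≢inner isHub₁ isInner₁ (sym e)))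
  ... | no h = ∨-introˡ (clique-adj (inj₁ isHub₁) k (λ e → h (sym e)))

  -- In `opened` the clique is settled, so only targets on the cycle have to be compared.
  ⊑-opened : (∀ a → adj hub₁ (vtx A a) ≡ false → S (vtx A a) ≡ false) → Fresh S B → S ⊑ opened
  ⊑-opened hA hB x e with vertexView x
  ... | inj₁ (A , a , refl) = hA a (trans (sym (opened-nearHub a)) e)
  ... | inj₁ (B , a , refl) = hB a
  ... | inj₂ k = ⊥-elim (true≢false (opened-done x k) e)

  atLeast-⊑-opened : S ⊑ opened → AtLeast (suc (P + P)) Dominator S
  atLeast-⊑-opened h = atLeast-mono (suc (P + P)) Dominator h (opened-D opened opened-nearHub opened-fresh)

  pending-after : ∀ {z} c e → Inner z → Pending z (afterMove (afterMove ∅ (edg c e)) z)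
  pending-after {z} c e i = mkPending i (cong₂ _∨_ (edge-inner c e i) (clique-irrefl (inj₂ i)))

  atLeast-∅ : AtLeast (3 + (P + P)) Dominator ∅
  atLeast-∅ = (edg A 0 , fresh-legal {∅} {A} 0 (λ _ → refl)) , reply
    where
    edge-reply : ∀ c e → Legal (afterMove ∅ (edg c e)) inner₁
    edge-reply c e = inner₂ , clique-adj (inj₂ isInner₁) (inj₂ isInner₂) inner-distinct , edge-inner c e isInner₂
    reply : ∀ v → Legal ∅ v → AtLeast (2 + (P + P)) Staller (afterMove ∅ v)
    reply v _ with moveView v
    -- The vertex `inner₁` dominates the clique except itself and so becomes the pending vertex.
    ... | inj₁ (A , e , refl) = inner₁ , edge-reply A e , pending-A (pending-after A e isInner₁)
      (near-untouched {afterMove ∅ v} (inner-vtx isInner₁ A) (λ _ → refl))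
      (λ a → cong₂ _∨_ (edge-cross A e a) (inner-vtx isInner₁ B a))
    ... | inj₁ (B , e , refl) = inner₁ , edge-reply B e , pending-B (pending-after B e isInner₁)
      (near-untouched {afterMove ∅ v} (inner-vtx isInner₁ B) (λ _ → refl))
      (λ a → cong₂ _∨_ (edge-cross B e a) (inner-vtx isInner₁ A a))
    ... | inj₂ k with otherInner v
    -- A clique vertex does not dominate itself, so `v` is what makes the reply `z` legal. The
    -- resulting position lies below `opened`.
    ... | z , i , z≢v = z , (v , clique-adj (inj₂ i) k z≢v , clique-irrefl k) ,
      atLeast-⊑-opened (⊑-opened (λ a e → cong₂ _∨_ (coverA k a e) (inner-vtx i A a))
        (λ a → cong₂ _∨_ (coverB k a) (inner-vtx i B a)))
      where
      coverA : Clique v → ∀ a → adj hub₁ (vtx A a) ≡ false → adj v (vtx A a) ≡ false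
      coverA (inj₁ h) a e = ¬true λ t → true≢false (hub-same h isHub₁ a t) e
      coverA (inj₂ i) a e = inner-vtx i A a
      coverB : Clique v → ∀ a → adj v (vtx B a) ≡ false
      coverB (inj₁ h) a = hub-B h a
      coverB (inj₂ i) a = inner-vtx i B a

-- Upper bounds

module Upper {k′ N : ℕ} {G : Graph N} (layout : Layout k′ G) where
  open Layout layout
  open Graph G
  open TotalDominationGame G using (afterMove)
  open Strategies G
  open Play layout

  private
    variable
      S : VSet N

  -- From here on no clique vertex is legal, and every legal move is an edge with an undominated
  -- target.
  record Quiet (S : VSet N) : Set where
    constructor mkQuiet
    field
      done : Done S
      at-0 : S (vtx A 0) ≡ true
      at-2 : S (vtx A 2) ≡ true

  quiet-after : ∀ v → Quiet S → Quiet (afterMove S v)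
  quiet-after {S} v (mkQuiet d t₀ t₂) = mkQuiet (done-after {S} v d) (∨-introˡ t₀) (∨-introˡ t₂)

  quiet-legal : ∀ {v} → Quiet S → Legal S v →
    ∃[ c ] ∃[ b ] v ≡ edg c b × (S (vtx c b) ≡ false ⊎ S (vtx c (suc b)) ≡ false)
  quiet-legal {S} {v} (mkQuiet d t₀ t₂) (x , e , f) with vertexView x
  ... | inj₂ k = ⊥-elim (true≢false (d x k) f)
  ... | inj₁ (c , i , refl) with moveView v
  ... | inj₂ (inj₂ z) = ⊥-elim (true≢false e (inner-vtx z c i))
  quiet-legal {S} (mkQuiet d t₀ t₂) (_ , e , f) | inj₁ (B , i , refl) | inj₂ (inj₁ h) =
    ⊥-elim (true≢false e (hub-B h i))
  quiet-legal {S} (mkQuiet d t₀ t₂) (_ , e , f) | inj₁ (A , i , refl) | inj₂ (inj₁ h) with hub-covers i h e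
  ... | inj₁ q = ⊥-elim (true≢false t₀ (trans (cong S (vtx-cong A 0 i (sym q))) f))
  ... | inj₂ q = ⊥-elim (true≢false t₂ (trans (cong S (vtx-cong A 2 i (sym q))) f))
  quiet-legal {S} _ (_ , e , f) | inj₁ (A , i , refl) | inj₁ (B , b , refl) =
    ⊥-elim (true≢false e (edge-cross B b i))
  quiet-legal {S} _ (_ , e , f) | inj₁ (B , i , refl) | inj₁ (A , b , refl) =
    ⊥-elim (true≢false e (edge-cross A b i))
  quiet-legal {S} _ (_ , e , f) | inj₁ (A , i , refl) | inj₁ (A , b , refl) = A , b , refl ,
    ⊎-map (λ q → trans (cong S (vtx-cong A b i (sym q))) f)
          (λ q → trans (cong S (vtx-cong A (suc b) i (sym q))) f) (edge-covers A i b e)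
  quiet-legal {S} _ (_ , e , f) | inj₁ (B , i , refl) | inj₁ (B , b , refl) = B , b , refl ,
    ⊎-map (λ q → trans (cong S (vtx-cong B b i (sym q))) f)
          (λ q → trans (cong S (vtx-cong B (suc b) i (sym q))) f) (edge-covers B i b e)

  up-untouched : ∀ {v} c a → Untouched v c → up (afterMove S v) c a ≡ up S c a
  up-untouched {S} c a h = cong (scan upper 0) (bits-untouched {S} c a h)

  module _ {c a} (r : Root S c a) where

    up-pos : ∀ {b} → S (vtx c b) ≡ false → 1 ≤ up S c a
    up-pos {b} f with %-locate (3 + triple k′) a b
    ... | j , j<L , h = false-pos (λ i → S (vtx c (i + a))) (suc L) j (m≤n⇒m≤1+n j<L)
      (trans (cong S (vtx-cong c (j + a) b h)) f) 0

    up-pos-edge : ∀ {b} → S (vtx c b) ≡ false ⊎ S (vtx c (suc b)) ≡ false → 1 ≤ up S c a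
    up-pos-edge = [ up-pos , up-pos ]′

    edge-move-gain : ∀ b → S (vtx c b) ≡ false ⊎ S (vtx c (suc b)) ≡ false →
      Gain (up S c a) (up (afterMove S (edg c b)) c a) (HasRes2 0 (bits (afterMove S (edg c b)) c a))
    edge-move-gain b f with edge-at-any {S} {c} {a} r b
    ... | j , x , y , m , refl , refl = edge-gain f m

  record Open (S : VSet N) (a b : ℕ) : Set where
    constructor mkOpen
    field
      quiet : Quiet S
      root : Root S A a
      root′ : Root S B b

  record Half (S : VSet N) (a : ℕ) : Set where
    constructor mkHalf
    field
      quiet : Quiet S
      root : Root S A a
      fresh : Fresh S B

  open-after : ∀ v {a b} → Open S a b → Open (afterMove S v) a b
  open-after {S} v (mkOpen q r r′) = mkOpen (quiet-after {S} v q) (root-after {S} v r) (root-after {S} v r′)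

  upTotal : VSet N → ℕ → ℕ → ℕ
  upTotal S a b = up S A a + up S B b

  AnyRes2 : VSet N → ℕ → ℕ → Set
  AnyRes2 S a b = HasRes2 0 (bits S A a) ⊎ HasRes2 0 (bits S B b)

  open-gain : ∀ {v a b} → Open S a b → Legal S v →
    1 ≤ upTotal S a b × Gain (upTotal S a b) (upTotal (afterMove S v) a b) (AnyRes2 (afterMove S v) a b)
  open-gain {S} {v} {a} {b} (mkOpen q r r′) λv with quiet-legal {S} q λv
  ... | A , e , refl , f = ≤-trans (up-pos-edge {S} r f) (m≤m+n _ _) ,
    subst (λ y → Gain (up S A a + up S B b) (up (afterMove S v) A a + y) (AnyRes2 (afterMove S v) a b))
      (sym (up-untouched {S} B b (edge-cross A e)))
      (weaken gain-comparison inj₁ (shiftʳ gain-comparison (up S B b) (edge-move-gain {S} r e f)))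
  ... | B , e , refl , f = ≤-trans (up-pos-edge {S} r′ f) (m≤n+m _ (up S A a)) ,
    subst (λ y → Gain (up S A a + up S B b) (y + up (afterMove S v) B b) (AnyRes2 (afterMove S v) a b))
      (sym (up-untouched {S} A a (edge-cross B e)))
      (weaken gain-comparison inj₂ (shift gain-comparison (up S A a) (edge-move-gain {S} r′ e f)))

  unit-move : ∀ {a b} → Open S a b → 1 ≤ upTotal S a b →
    ∃[ v ] Legal S v × suc (upTotal (afterMove S v) a b) ≤ upTotal S a b
  unit-move {S} {a} {b} (mkOpen q r r′) h with +-pos (up S A a) h
  ... | inj₁ h = let e , l , d = play {S} r (upper-unit-move (bits S A a) (bits-endsTrue {S} {true} A a r) h) in
    edg A e , l , +-mono-≤ d (≤-reflexive (up-untouched {S} B b (edge-cross A e)))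
  ... | inj₂ h = let e , l , d = play {S} r′ (upper-unit-move (bits S B b) (bits-endsTrue {S} {true} B b r′) h) in
    edg B e , l , subst (λ y → suc (y + up (afterMove S (edg B e)) B b) ≤ up S A a + up S B b)
      (sym (up-untouched {S} A a (edge-cross B e))) (suc≤-shift (up S A a) d)

  double-move : ∀ {a b} → Open S a b → AnyRes2 S a b →
    ∃[ v ] Legal S v × 2 + upTotal (afterMove S v) a b ≤ upTotal S a b
  double-move {S} {a} {b} (mkOpen q r r′) (inj₁ ρ) =
    let e , l , d = play {S} r (upper-double-move (bits S A a) (bits-endsTrue {S} {true} A a r) ρ) in
    edg A e , l , +-mono-≤ d (≤-reflexive (up-untouched {S} B b (edge-cross A e)))
  double-move {S} {a} {b} (mkOpen q r r′) (inj₂ ρ) =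
    let e , l , d = play {S} r′ (upper-double-move (bits S B b) (bits-endsTrue {S} {true} B b r′) ρ) in
    edg B e , l , subst (λ y → 2 + (y + up (afterMove S (edg B e)) B b) ≤ up S A a + up S B b)
      (sym (up-untouched {S} A a (edge-cross B e)))
      (subst (_≤ up S A a + up S B b) (trans (+-suc (up S A a) _) (cong suc (+-suc (up S A a) _)))
        (+-monoʳ-≤ (up S A a) d))

  open-S : ∀ t S a b → Open S a b → upTotal S a b ≤ t → AtMost t Staller S
  open-D : ∀ t S a b → Open S a b → upTotal S a b ≤ t → AtMost t Dominator S
  open-D-res2 : ∀ t S a b → Open S a b → AnyRes2 S a b → upTotal S a b ≤ suc t → AtMost t Dominator S
  open-S zero S a b s h v l = 1+n≰n (≤-trans (proj₁ (open-gain {S} s l)) h)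
  open-S (suc t) S a b s h v l with proj₂ (open-gain {S} s l)
  ... | inj₁ d = open-D t _ a b (open-after {S} v s) (s≤s⁻¹ (≤-trans d h))
  ... | inj₂ (ρ , d) = open-D-res2 t _ a b (open-after {S} v s) ρ (≤-trans d h)
  open-D zero S a b s h v l = 1+n≰n (≤-trans (proj₁ (open-gain {S} s l)) h)
  open-D (suc t) S a b s h with over? S
  ... | inj₁ o = inj₁ o
  ... | inj₂ (_ , l₀) = let v , l , d = unit-move {S} s (proj₁ (open-gain {S} s l₀)) in
    inj₂ (v , l , open-S t _ a b (open-after {S} v s) (s≤s⁻¹ (≤-trans d h)))
  open-D-res2 zero S a b s ρ h with double-move {S} s ρ
  ... | _ , _ , d with ≤-trans d h
  ... | s≤s ()
  open-D-res2 (suc t) S a b s ρ h = let v , l , d = double-move {S} s ρ in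
    inj₂ (v , l , open-S t _ a b (open-after {S} v s) (s≤s⁻¹ (s≤s⁻¹ (≤-trans d h))))

  open-B : ∀ b {a} → Half S a → Open (afterMove S (edg B b)) a b
  open-B {S} b (mkHalf q r f) = mkOpen (quiet-after {S} (edg B b) q) (root-after {S} (edg B b) r)
    (nearEdge-root {afterMove S (edg B b)} (fresh-nearEdge {S} b f))

  open-B-total : ∀ b {a} → Half S a → upTotal (afterMove S (edg B b)) a b ≡ up S A a + P
  open-B-total {S} b {a} (mkHalf q r f) =
    cong₂ _+_ (up-untouched {S} A a (edge-cross B b)) (nearEdge-up {afterMove S (edg B b)} (fresh-nearEdge {S} b f))

  half-edge : ∀ e {a} → Half S a → Half (afterMove S (edg A e)) a
  half-edge {S} e (mkHalf q r f) = mkHalf (quiet-after {S} (edg A e) q) (root-after {S} (edg A e) r)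
    (fresh-untouched {S} {edg A e} {B} (edge-cross A e) f)

  -- On Staller's turn the bound on side A is even. If each move there gains one, side A is used up
  -- in pairs and Staller has to enter B. If it is used up on Dominator's turn, the odd bound of
  -- `half-D` has left him one spare move for entering.
  half-S : ∀ q S a → Half S a → up S A a ≤ q * 2 → AtMost (q * 2 + P) Staller S
  half-D : ∀ q S a → Half S a → up S A a ≤ suc (q * 2) → AtMost (suc (q * 2 + P)) Dominator S
  half-D-res2 : ∀ q S a → Half S a → HasRes2 0 (bits S A a) → up S A a ≤ 2 + q * 2 → AtMost (suc (q * 2 + P)) Dominator S
  half-S q S a s h = subst (λ t → AtMost t Staller S) (sym (+-suc (q * 2) (1 + p))) reply
    where
    reply : ∀ v → Legal S v → AtMost (q * 2 + (1 + p)) Dominator (afterMove S v)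
    reply v l with quiet-legal {S} (Half.quiet s) l
    -- Staller's entry leaves a run of residue 2, and Dominator's double move on it pays for the
    -- entering move.
    ... | B , b , refl , _ = open-D-res2 (q * 2 + (1 + p)) _ a b (open-B {S} b s)
      (inj₂ (nearEdge-res2 {afterMove S v} (fresh-nearEdge {S} b (Half.fresh s))))
      (≤-trans (≤-reflexive (open-B-total {S} b s)) (subst (up S A a + P ≤_) (+-suc (q * 2) (1 + p)) (+-monoˡ-≤ P h)))
    ... | A , e , refl , f = inA q h (edge-move-gain {S} (Half.root s) e f)
      where
      inA : ∀ q → up S A a ≤ q * 2 →
        Gain (up S A a) (up (afterMove S v) A a) (HasRes2 0 (bits (afterMove S v) A a)) →
        AtMost (q * 2 + (1 + p)) Dominator (afterMove S v)
      inA zero h _ = ⊥-elim (1+n≰n (≤-trans (up-pos-edge {S} (Half.root s) f) h))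
      inA (suc q) h d = subst (λ t → AtMost t Dominator (afterMove S v)) (cong suc (+-suc (q * 2) (1 + p))) (cont d)
        where
        cont : Gain (up S A a) (up (afterMove S v) A a) (HasRes2 0 (bits (afterMove S v) A a)) →
          AtMost (suc (q * 2 + P)) Dominator (afterMove S v)
        cont (inj₁ d) = half-D q _ a (half-edge {S} e s) (s≤s⁻¹ (≤-trans d h))
        cont (inj₂ (ρ , d)) = half-D-res2 q _ a (half-edge {S} e s) ρ (≤-trans d h)
  half-D q S a s h with up S A a in eq
  -- Side A is exhausted, so Dominator enters B with the spare move of the odd bound.
  ... | zero = inj₂ (edg B 0 , fresh-legal {S} {B} 0 (Half.fresh s) , open-S (q * 2 + P) _ a 0 (open-B {S} 0 s)
    (≤-trans (≤-reflexive (trans (open-B-total {S} 0 s) (cong (_+ P) eq))) (m≤n+m P (q * 2))))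
  ... | suc x with play {S} (Half.root s) (upper-unit-move (bits S A a) (bits-endsTrue {S} {true} A a (Half.root s))
                     (≤-trans (s≤s z≤n) (≤-reflexive (sym eq))))
  ... | e , l , d = inj₂ (edg A e , l , half-S q _ a (half-edge {S} e s)
    (s≤s⁻¹ (≤-trans d (≤-trans (≤-reflexive eq) h))))
  half-D-res2 q S a s ρ h =
    let e , l , d = play {S} (Half.root s) (upper-double-move (bits S A a) (bits-endsTrue {S} {true} A a (Half.root s)) ρ) in
    inj₂ (edg A e , l , half-S q _ a (half-edge {S} e s) (s≤s⁻¹ (s≤s⁻¹ (≤-trans d h))))

  -- Within the clique `hub₁` fails to dominate only itself, and that vertex is dominated
  -- beforehand. What remains is quiet, and side A has weight P.
  atMost-hub : S hub₁ ≡ true → Fresh S A → Fresh S B → AtMost (suc (P + P)) Dominator S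
  atMost-hub {S} t fA fB = inj₂ (hub₁ , (vtx A 0 , hub-0 isHub₁ , fA 0) ,
    half-S (suc k′) S⁺ 0 (mkHalf (mkQuiet done (∨-introʳ (S (vtx A 0)) (hub-0 isHub₁)) (∨-introʳ (S (vtx A 2)) (hub-2 isHub₁)))
      (∨-introʳ (S (vtx A 0)) (hub-0 isHub₁)) (fresh-untouched {S} {hub₁} {B} (hub-B isHub₁) fB))
      (≤-reflexive (nearHub-up {S⁺} λ a → cong (_∨ adj hub₁ (vtx A a)) (fA a))))
    where
    S⁺ : VSet N
    S⁺ = afterMove S hub₁
    done : Done S⁺
    done x k with x Fin.≟ hub₁
    ... | yes refl = ∨-introˡ t
    ... | no h = ∨-introʳ (S x) (clique-adj (inj₁ isHub₁) k (λ e → h (sym e)))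

-- From the cycle length to the numerical values.

length-decomposition : ∀ n → 8 ≤ n → n % 6 ≡ 2 → ∃[ k′ ] n ≡ (4 + triple k′) * 2
length-decomposition n 8≤n n%6 with n / 6 | m≡m%n+[m/n]*n n 6
... | zero | e rewrite n%6 | e with 8≤n
... | s≤s (s≤s ())
length-decomposition n 8≤n n%6 | suc k′ | e = k′ , trans e (trans (cong (_+ suc k′ * 6) n%6) (sixfold k′))
  where
  sixfold : ∀ k → 2 + suc k * 6 ≡ (4 + triple k) * 2
  sixfold zero = refl
  sixfold (suc k) = cong (6 +_) (sixfold k)

module _ (k′ n m : ℕ) (n≡ : n ≡ (4 + triple k′) * 2) (4≤m : 4 ≤ m) where
  private
    lay : Layout k′ (Gnm n m)
    lay = layout k′ n m n≡ 4≤m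
  open Layout lay
  open Graph (Gnm n m) using (adj)
  open Strategies (Gnm n m)
  open Play lay using (P; Fresh)

  private
    fuel : 3 + (P + P) ≤ suc (n + m)
    fuel rewrite n≡ = ≤-trans (bound k′) (≤-trans (m≤m+n _ m) (n≤1+n _))
      where
      bound : ∀ k → 3 + ((2 + k * 2) + (2 + k * 2)) ≤ (4 + triple k) * 2
      bound zero = n≤1+n 7
      bound (suc k) = subst (_≤ 6 + (4 + triple k) * 2) (four k) (+-mono-≤ (m≤n+m 4 2) (bound k))
        where
        four : ∀ k → 4 + (3 + ((2 + k * 2) + (2 + k * 2))) ≡ 3 + ((2 + (2 + k * 2)) + (2 + (2 + k * 2)))
        four = solve-∀

    w₁-hub : w₁ n m hub₁ ≡ true
    w₁-hub = ≡ᵇ-complete (toℕ-w₁ k′ n m n≡ 4≤m)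

    w₁-only : ∀ x → x ≢ hub₁ → w₁ n m x ≡ false
    w₁-only x x≢ = ≡ᵇ-false λ e → x≢ (Fin.toℕ-injective (trans e (sym (toℕ-w₁ k′ n m n≡ 4≤m))))

    w₁-fresh : ∀ c → Fresh (w₁ n m) c
    w₁-fresh c a = w₁-only (vtx c a) λ e → true≢false
      (trans (cong (adj inner₁) e) (clique-adj (inj₂ isInner₁) (inj₁ isHub₁) λ q → Token.hub≢inner lay isHub₁ isInner₁ (sym q)))
      (inner-vtx isInner₁ c a)

    atMost-w₁ : AtMost (suc (P + P)) Dominator (w₁ n m)
    atMost-w₁ = Upper.atMost-hub lay w₁-hub (w₁-fresh A) (w₁-fresh B)

  value-w₁ : TotalDominationGame.γgt∣ (Gnm n m) (w₁ n m) ≡ suc (P + P)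
  value-w₁ = ≤-antisym (atMost-value (suc (n + m)) (suc (P + P)) Dominator (w₁ n m) atMost-w₁)
    (atLeast-value (suc (n + m)) (suc (P + P)) Dominator (w₁ n m)
      (≤-trans (≤-trans (n≤1+n _) (n≤1+n _)) fuel)
      (Token.atLeast-⊑-opened lay (Token.⊑-opened lay (λ a _ → w₁-fresh A a) (w₁-fresh B))))

  value-∅ : TotalDominationGame.γgt (Gnm n m) ≡ 3 + (P + P)
  value-∅ = ≤-antisym
    (atMost-value (suc (n + m)) (3 + (P + P)) Dominator ∅
      (atMost-+2 {s = hub₁} (suc (P + P)) Dominator ((λ _ _ → refl) , (λ x x≢ _ → w₁-only x x≢) , w₁-hub) atMost-w₁))
    (atLeast-value (suc (n + m)) (3 + (P + P)) Dominator ∅ fuel (Token.atLeast-∅ lay))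

  -- The division is exact, as 2n = 3(2P + 1) + 1.
  third : (2 * n ∸ 1) / 3 ≡ suc (P + P)
  third = trans (cong (λ x → (x ∸ 1) / 3) (trans (cong (2 *_) n≡) (fourfold k′))) (m*n/n≡m (suc (P + P)) 3)
    where
    fourfold : ∀ k → 2 * ((4 + triple k) * 2) ≡ suc (suc ((2 + k * 2) + (2 + k * 2)) * 3)
    fourfold zero = refl
    fourfold (suc k) = trans (step₁ (triple k)) (trans (cong (12 +_) (fourfold k)) (step₂ k))
      where
      step₁ : ∀ t → 2 * ((4 + (3 + t)) * 2) ≡ 12 + 2 * ((4 + t) * 2)
      step₁ = solve-∀
      step₂ : ∀ k → 12 + suc (suc ((2 + k * 2) + (2 + k * 2)) * 3) ≡
        suc (suc ((2 + (2 + k * 2)) + (2 + (2 + k * 2))) * 3)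
      step₂ = solve-∀

theorem2p2 : (n m : ℕ) → 8 ≤ n → 4 ≤ m → n % 6 ≡ 2 →
    (TotalDominationGame.γgt (Gnm n m) ≡ (2 * n ∸ 1) / 3 + 2)
    × (TotalDominationGame.γgt∣ (Gnm n m) (w₁ n m) ≡ (2 * n ∸ 1) / 3)
theorem2p2 n m 8≤n 4≤m n%6 with length-decomposition n 8≤n n%6
... | k′ , n≡ =
  trans (value-∅ k′ n m n≡ 4≤m) (sym (trans (cong (_+ 2) t) (+-comm _ 2))) , trans (value-w₁ k′ n m n≡ 4≤m) (sym t)
  where
  t : (2 * n ∸ 1) / 3 ≡ _
  t = third k′ n m n≡ 4≤m
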